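{- For every $\varepsilon > 0$ and every integer $k \ge 2$ there is an $\eta > 0$ such that for all sufficiently large $n$ the following holds. If $\mathcal{F}$ is a family of subsets of $[n]$ of size $m = |\mathcal{F}| \ge (1-\eta) k 2^{n/k}$ with at least $\left(1 - \frac{1+\eta}{k}\right)\binom{m}{2}$ comparable pairs, then all but at most $\varepsilon m$ sets of $\mathcal{F}$ are contained in a tower of $k$ cubes of dimension $n/k$.
   Context: A comparable pair in $\mathcal{F}$ is an unordered pair of distinct sets $A,B\in\mathcal{F}$ with $A\subseteq B$ or $B \subseteq A$. For sets $X \subseteq Y \subseteq [n]$, the subcube between them is $\{F \subseteq [n] : X \subseteq F \subseteq Y\}$, of dimension $|Y|-|X|$. A tower of $k$ cubes of dimension $n/k$ is a family of the form $\bigcup_{i=1}^k \{F \subseteq [n]: X_{i-1} \subseteq F \subseteq X_i\}$ where $\emptyset = X_0 \subseteq X_1 \subseteq \dots \subseteq X_k = [n]$ is a chain with $|X_i| - |X_{i-1}| = n/k$ for each $i$. -}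

module Defs where

open import Data.Nat using (ℕ; zero; suc; _+_; _*_; _^_; _≤_)
open import Data.Nat.Combinatorics using (_C_)
open import Data.Integer using (+_)
open import Data.Rational using (ℚ; _/_; 0ℚ) renaming (_*_ to _*ℚ_)
open import Data.Fin using (Fin; inject₁; fromℕ) renaming (zero to fzero; suc to fsuc)
open import Data.Fin.Subset using (Subset; _⊆_; ∣_∣; ⊥; ⊤)
open import Data.Fin.Subset.Properties using (_⊆?_)
open import Data.List using (List; []; _∷_; length; filter)
open import Data.Product using (Σ; ∃; _×_)
open import Relation.Binary.PropositionalEquality using (_≡_)
open import Relation.Nullary using (Dec; yes; no)
open import Data.Sum using (_⊎_)

ℕ→ℚ : ℕ → ℚ
ℕ→ℚ n = + n / 1

-- p / k for a natural number k (k = 0 gives 0; only used with k ≥ 2)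
_/ℕ_ : ℚ → ℕ → ℚ
p /ℕ zero = 0ℚ
p /ℕ suc j = p *ℚ (+ 1 / suc j)

Comparable : ∀ {n} → Subset n → Subset n → Set
Comparable A B = A ⊆ B ⊎ B ⊆ A

comparable? : ∀ {n} (A B : Subset n) → Dec (Comparable A B)
comparable? A B with A ⊆? B | B ⊆? A
... | yes p | _ = yes (_⊎_.inj₁ p)
... | no _ | yes q = yes (_⊎_.inj₂ q)
... | no ¬p | no ¬q = no λ { (_⊎_.inj₁ p) → ¬p p ; (_⊎_.inj₂ q) → ¬q q }

-- number of comparable pairs {F_i, F_j}, i < j, in a list of sets
-- (for a duplicate-free list this is the number of comparable unordered pairs
--  of distinct members of the family)
comparablePairs : ∀ {n} → List (Subset n) → ℕ
comparablePairs [] = 0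
comparablePairs (A ∷ As) = length (filter (comparable? A) As) + comparablePairs As

record Tower (n k d : ℕ) : Set where
  field
    X : Fin (suc k) → Subset n
    X-first : X fzero ≡ ⊥
    X-last : X (fromℕ k) ≡ ⊤
    X-mono : (i : Fin k) → X (inject₁ i) ⊆ X (fsuc i)
    X-step : (i : Fin k) → ∣ X (fsuc i) ∣ ≡ ∣ X (inject₁ i) ∣ + d

InTower : ∀ {n k d} → Tower n k d → Subset n → Set
InTower {k = k} T F = Σ (Fin k) λ i → (Tower.X T (inject₁ i) ⊆ F) × (F ⊆ Tower.X T (fsuc i))

{-# OPTIONS --safe #-}

-- Let m = |F|. Call all members of F level 0, and let level r + 1 consist of the level-r sets having at
-- least m / b level-r sets below them. If level k had m / b members, averaging over t-tuples of level-r
-- sets would give sets U₀, …, U_k such that every interval [Uᵣ, Uᵣ₊₁], and [∅, U₀], contains 2^(-o(n)) m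
-- members of F and thus has dimension close to d; these k + 1 dimensions would exceed n = k d. So the
-- classes of sets of rank (= highest level) 0, …, k - 1 cover almost all of F. Few pairs are comparable
-- inside a class or against the rank order, and comparabilities are as frequent as in the Turán graph, so
-- every class has about m / k members and almost all pairs from different classes are nested in rank order.
--
-- Discard the few sets which are not nested with almost all sets of the other classes. Each point x of [n]
-- is then pure (membership is decided by the rank, except in one class) or weird (almost constant on every
-- class, and changing from absent to present as the rank grows). If class l has R_l pure points and q points
-- are weird, then its size is at most 2^(R_l) (1 + 1/4k)^q, up to a few irregular members. Multiplying over l,
-- the product of the class sizes is at most (2/3)^q 2^n, whereas every class has at least (1 - 1/4k) 2^d
-- members. Hence q = 0 and R_l = d for all l, and the pure points of classes < i form the i-th set of the tower.

module Submission where

open import Defs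
open import Data.Fin.Subset using (Subset)
open import Data.List using (List; length)
open import Data.List.Membership.Propositional using (_∈_)
open import Data.List.Relation.Unary.Unique.Propositional using (Unique)
open import Data.Product using (Σ; ∃; _×_; _,_; proj₁; proj₂)
open import Data.Sum using (_⊎_; inj₁; inj₂; [_,_])
open import Relation.Binary.PropositionalEquality hiding ([_])

-- Inequalities are kept free of division: `c * x ≤ y` stands for x ≤ y / c. Tuples of bounded
-- length suffice for the averaging. A union lying above fewer than m / 2^e level-r sets comes from
-- at most (m / 2^e)^t tuples, and [n] has only 2^n subsets, so such unions are negligible once e t
-- exceeds n by a margin. With t fixed, e and the loss c are linear in d; all that matters is (k +
-- 1) c < d, so that k + 1 intervals of dimension about d - c do not fit into n = k d. The obstacle
-- to an exact tower is the weird points, which no error term rules out. A budget of factors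
-- excludes them: a pure point contributes 2 to the product of the class sizes, because only one
-- class is free there, whereas a weird point contributes at most (1 + 1/4k)^k ≤ 4/3 and so loses a
-- factor 2/3. The size hypothesis gives up only (1 - 1/4k)^k ≥ 3/4, which is more than 2/3, so not
-- even one weird point fits.

module Families where

  open import Data.Bool using (Bool; true; false; T)
  import Data.Bool.Properties as Bool
  open import Data.Empty using () renaming (⊥ to Empty; ⊥-elim to Empty-elim)
  open import Data.Fin using (Fin; zero; suc; toℕ; fromℕ<)
  open import Data.Fin.Properties using (toℕ<n; toℕ-fromℕ<; toℕ-inject₁; toℕ-fromℕ)
  open import Data.Fin.Subset using (_⊆_; ∣_∣; _∪_; ⊥; ⊤) renaming (_∈_ to _∈ˢ_)
  open import Data.Fin.Subset.Properties using (_⊆?_; _∈?_; ⊆-refl; ⊆-antisym; ⊆⊤; ⊥⊆; ∣⊤∣≡n; p⊆p∪q; q⊆p∪q; x∈p∪q⁻)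
  open import Data.List using ([]; _∷_; _++_; map; filter; cartesianProductWith; allFin)
  open import Data.List.Membership.Propositional using (find; lose)
  open import Data.List.Membership.Propositional.Properties using (∈-++⁺ˡ; ∈-++⁺ʳ; ∈-map⁺; ∈-allFin; ∈-filter⁺; ∈-filter⁻)
  open import Data.List.Properties using (map-tabulate; length-++; length-map; length-tabulate)
  open import Data.List.Relation.Unary.All using (All; []; _∷_)
  open import Data.List.Relation.Unary.AllPairs using ([]; _∷_)
  open import Data.List.Relation.Unary.Any using (here; there; any?)
  import Data.List.Relation.Unary.Unique.Propositional.Properties as Unique
  open import Data.Nat
  open import Data.Nat.DivMod using (m≡m%n+[m/n]*n; m%n<n; m/n*n≤m)
  open import Data.Nat.Properties
  open import Data.Nat.Tactic.RingSolver using (solve-∀)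
  open import Data.Unit using (tt) renaming (⊤ to Unit)
  open import Data.Vec as Vec using ([]; _∷_; lookup; tabulate)
  open import Data.Vec.Properties using (≡-dec; []=⇒lookup; lookup⇒[]=; lookup∘tabulate)
  open import Relation.Binary using (DecidableEquality; tri<; tri≈; tri>)
  open import Relation.Nullary using (Dec; yes; no; ¬_; contradiction; does)
  open import Relation.Nullary.Decidable using (¬?; _×-dec_; _⊎-dec_; decidable-stable; dec-true)

  -- Finite sums, products and indicators

  private
    variable
      n : ℕ
      X Y Z φ ψ χ : Set

  ∑ : List X → (X → ℕ) → ℕ
  ∑ []       f = 0
  ∑ (x ∷ xs) f = f x + ∑ xs f

  ∏ : List X → (X → ℕ) → ℕ
  ∏ []       f = 1
  ∏ (x ∷ xs) f = f x * ∏ xs f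

  ∑-mono : ∀ (xs : List X) {f g : X → ℕ} → (∀ x → x ∈ xs → f x ≤ g x) → ∑ xs f ≤ ∑ xs g
  ∑-mono []       le = z≤n
  ∑-mono (x ∷ xs) le = +-mono-≤ (le x (here refl)) (∑-mono xs (λ y y∈ → le y (there y∈)))

  ∑-cong : ∀ (xs : List X) {f g : X → ℕ} → (∀ x → f x ≡ g x) → ∑ xs f ≡ ∑ xs g
  ∑-cong []       eq = refl
  ∑-cong (x ∷ xs) eq = cong₂ _+_ (eq x) (∑-cong xs eq)

  interchange : ∀ a b c d → (a + b) + (c + d) ≡ (a + c) + (b + d)
  interchange = solve-∀

  ∑-+ : ∀ (xs : List X) (f g : X → ℕ) → ∑ xs (λ x → f x + g x) ≡ ∑ xs f + ∑ xs g
  ∑-+ []       f g = refl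
  ∑-+ (x ∷ xs) f g = trans (cong (f x + g x +_) (∑-+ xs f g)) (interchange (f x) (g x) (∑ xs f) (∑ xs g))

  ∑-*ˡ : ∀ (xs : List X) c (f : X → ℕ) → ∑ xs (λ x → c * f x) ≡ c * ∑ xs f
  ∑-*ˡ []       c f = sym (*-zeroʳ c)
  ∑-*ˡ (x ∷ xs) c f = trans (cong (c * f x +_) (∑-*ˡ xs c f)) (sym (*-distribˡ-+ c (f x) (∑ xs f)))

  ∑-*ʳ : ∀ (xs : List X) c (f : X → ℕ) → ∑ xs (λ x → f x * c) ≡ ∑ xs f * c
  ∑-*ʳ xs c f = trans (∑-cong xs (λ x → *-comm (f x) c)) (trans (∑-*ˡ xs c f) (*-comm c (∑ xs f)))

  ∑-const : ∀ (xs : List X) c → ∑ xs (λ _ → c) ≡ length xs * c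
  ∑-const []       c = refl
  ∑-const (x ∷ xs) c = cong (c +_) (∑-const xs c)

  ∑-zero : ∀ (xs : List X) → ∑ xs (λ _ → 0) ≡ 0
  ∑-zero xs = trans (∑-const xs 0) (*-zeroʳ (length xs))

  ∑-swap : ∀ (xs : List X) (ys : List Y) (f : X → Y → ℕ) →
           ∑ xs (λ x → ∑ ys (f x)) ≡ ∑ ys (λ y → ∑ xs (λ x → f x y))
  ∑-swap []       ys f = sym (∑-zero ys)
  ∑-swap (x ∷ xs) ys f = trans (cong (∑ ys (f x) +_) (∑-swap xs ys f)) (sym (∑-+ ys (f x) (λ y → ∑ xs (λ x → f x y))))

  ∑-++ : ∀ (xs ys : List X) f → ∑ (xs ++ ys) f ≡ ∑ xs f + ∑ ys f
  ∑-++ []       ys f = refl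
  ∑-++ (x ∷ xs) ys f = trans (cong (f x +_) (∑-++ xs ys f)) (sym (+-assoc (f x) (∑ xs f) (∑ ys f)))

  ∑-map : ∀ (h : X → Y) (xs : List X) f → ∑ (map h xs) f ≡ ∑ xs (λ x → f (h x))
  ∑-map h []       f = refl
  ∑-map h (x ∷ xs) f = cong (f (h x) +_) (∑-map h xs f)

  ∑-cartesianProductWith : ∀ (h : X → Y → Z) (xs : List X) (ys : List Y) f →
    ∑ (cartesianProductWith h xs ys) f ≡ ∑ xs (λ x → ∑ ys (λ y → f (h x y)))
  ∑-cartesianProductWith h []       ys f = refl
  ∑-cartesianProductWith h (x ∷ xs) ys f =
    trans (∑-++ (map (h x) ys) (cartesianProductWith h xs ys) f)
          (cong₂ _+_ (∑-map (h x) ys f) (∑-cartesianProductWith h xs ys f))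

  ∑-∑-* : ∀ (xs : List X) (ys : List Y) f g → ∑ xs (λ x → ∑ ys (λ y → f x * g y)) ≡ ∑ xs f * ∑ ys g
  ∑-∑-* xs ys f g = trans (∑-cong xs (λ x → ∑-*ˡ ys (f x) g)) (∑-*ʳ xs (∑ ys g) f)

  f≤∑ : ∀ (xs : List X) f {x} → x ∈ xs → f x ≤ ∑ xs f
  f≤∑ (_ ∷ xs) f (here refl) = m≤m+n _ _
  f≤∑ (y ∷ xs) f (there x∈)  = ≤-trans (f≤∑ xs f x∈) (m≤n+m _ (f y))

  ∏-mono : ∀ (xs : List X) {f g : X → ℕ} → (∀ x → x ∈ xs → f x ≤ g x) → ∏ xs f ≤ ∏ xs g
  ∏-mono []       le = ≤-refl
  ∏-mono (x ∷ xs) le = *-mono-≤ (le x (here refl)) (∏-mono xs (λ y y∈ → le y (there y∈)))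

  ∏-cong : ∀ (xs : List X) {f g : X → ℕ} → (∀ x → f x ≡ g x) → ∏ xs f ≡ ∏ xs g
  ∏-cong []       eq = refl
  ∏-cong (x ∷ xs) eq = cong₂ _*_ (eq x) (∏-cong xs eq)

  *-interchange : ∀ a b c d → (a * b) * (c * d) ≡ (a * c) * (b * d)
  *-interchange = solve-∀

  ∏-* : ∀ (xs : List X) (f g : X → ℕ) → ∏ xs (λ x → f x * g x) ≡ ∏ xs f * ∏ xs g
  ∏-* []       f g = refl
  ∏-* (x ∷ xs) f g = trans (cong (f x * g x *_) (∏-* xs f g)) (*-interchange (f x) (g x) (∏ xs f) (∏ xs g))

  ∏-const : ∀ (xs : List X) c → ∏ xs (λ _ → c) ≡ c ^ length xs
  ∏-const []       c = refl
  ∏-const (x ∷ xs) c = cong (c *_) (∏-const xs c)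

  ∏-^ : ∀ (xs : List X) c (f : X → ℕ) → ∏ xs (λ x → c ^ f x) ≡ c ^ ∑ xs f
  ∏-^ []       c f = refl
  ∏-^ (x ∷ xs) c f = trans (cong (c ^ f x *_) (∏-^ xs c f)) (sym (^-distribˡ-+-* c (f x) (∑ xs f)))

  ∏-map : ∀ (h : X → Y) (xs : List X) f → ∏ (map h xs) f ≡ ∏ xs (λ x → f (h x))
  ∏-map h []       f = refl
  ∏-map h (x ∷ xs) f = cong (f (h x) *_) (∏-map h xs f)

  𝟙 : Dec φ → ℕ
  𝟙 (yes _) = 1
  𝟙 (no _)  = 0

  𝟙-yes : (d : Dec φ) → φ → 𝟙 d ≡ 1
  𝟙-yes (yes _) p = refl
  𝟙-yes (no ¬p) p = contradiction p ¬p

  𝟙-no : (d : Dec φ) → ¬ φ → 𝟙 d ≡ 0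
  𝟙-no (yes p) ¬p = contradiction p ¬p
  𝟙-no (no _)  ¬p = refl

  𝟙≤1 : (d : Dec φ) → 𝟙 d ≤ 1
  𝟙≤1 (yes _) = ≤-refl
  𝟙≤1 (no _)  = z≤n

  𝟙-mono : (d : Dec φ) (e : Dec ψ) → (φ → ψ) → 𝟙 d ≤ 𝟙 e
  𝟙-mono (yes p) e f = ≤-reflexive (sym (𝟙-yes e (f p)))
  𝟙-mono (no _)  e f = z≤n

  𝟙-cong : (d : Dec φ) (e : Dec ψ) → (φ → ψ) → (ψ → φ) → 𝟙 d ≡ 𝟙 e
  𝟙-cong d e f g = ≤-antisym (𝟙-mono d e f) (𝟙-mono e d g)

  𝟙-cover : (d : Dec φ) (e : Dec ψ) (e′ : Dec χ) → (φ → ψ ⊎ χ) → 𝟙 d ≤ 𝟙 e + 𝟙 e′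
  𝟙-cover (no _)  e e′ f = z≤n
  𝟙-cover (yes p) e e′ f with f p
  ... | inj₁ q rewrite 𝟙-yes e q = s≤s z≤n
  ... | inj₂ r rewrite 𝟙-yes e′ r = m≤n+m 1 (𝟙 e)

  𝟙-disjoint : (d : Dec φ) (d′ : Dec ψ) (e : Dec χ) → (φ → ψ → Empty) → (φ → χ) → (ψ → χ) → 𝟙 d + 𝟙 d′ ≤ 𝟙 e
  𝟙-disjoint (no _)  d′      e dis f g = 𝟙-mono d′ e g
  𝟙-disjoint (yes p) (no _)  e dis f g rewrite 𝟙-yes e (f p) = ≤-refl
  𝟙-disjoint (yes p) (yes q) e dis f g = Empty-elim (dis p q)

  𝟙-* : (d : Dec φ) (d′ : Dec ψ) (e : Dec χ) → (φ → ψ → χ) → (χ → φ × ψ) → 𝟙 e ≡ 𝟙 d * 𝟙 d′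
  𝟙-* (yes p) (yes q) e f g = 𝟙-yes e (f p q)
  𝟙-* (yes p) (no ¬q) e f g = 𝟙-no e (λ r → ¬q (proj₂ (g r)))
  𝟙-* (no ¬p) d′      e f g = 𝟙-no e (λ r → ¬p (proj₁ (g r)))

  length-filter : {P : X → Set} (P? : ∀ x → Dec (P x)) (xs : List X) → length (filter P? xs) ≡ ∑ xs (λ x → 𝟙 (P? x))
  length-filter P? [] = refl
  length-filter P? (x ∷ xs) with P? x
  ... | yes _ = cong suc (length-filter P? xs)
  ... | no _  = length-filter P? xs

  ∑-filter : {P : X → Set} (P? : ∀ x → Dec (P x)) (xs : List X) (f : X → ℕ) →
             ∑ (filter P? xs) f ≡ ∑ xs (λ x → 𝟙 (P? x) * f x)
  ∑-filter P? [] f = refl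
  ∑-filter P? (x ∷ xs) f with P? x
  ... | yes _ = cong₂ _+_ (sym (+-identityʳ (f x))) (∑-filter P? xs f)
  ... | no _  = ∑-filter P? xs f

  -- Weighted counting of families of subsets

  _≟ˢ_ : DecidableEquality (Subset n)
  _≟ˢ_ = ≡-dec Bool._≟_

  subsets : ∀ n → List (Subset n)
  subsets zero    = [] ∷ []
  subsets (suc n) = map (true ∷_) (subsets n) ++ map (false ∷_) (subsets n)

  length-subsets : ∀ n → length (subsets n) ≡ 2 ^ n
  length-subsets zero    = refl
  length-subsets (suc n) = begin-equality
    length (map (true ∷_) (subsets n) ++ map (false ∷_) (subsets n))
      ≡⟨ length-++ (map (true ∷_) (subsets n)) ⟩
    length (map (true ∷_) (subsets n)) + length (map (false ∷_) (subsets n))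
      ≡⟨ cong₂ _+_ (trans (length-map (true ∷_) (subsets n)) (length-subsets n)) (trans (length-map (false ∷_) (subsets n)) (length-subsets n)) ⟩
    2 ^ n + 2 ^ n
      ≡⟨ cong (2 ^ n +_) (sym (+-identityʳ (2 ^ n))) ⟩
    2 * 2 ^ n ∎
    where open ≤-Reasoning

  ∈-subsets : (A : Subset n) → A ∈ subsets n
  ∈-subsets []          = here refl
  ∈-subsets {suc n} (true ∷ A)  = ∈-++⁺ˡ (∈-map⁺ (true ∷_) (∈-subsets A))
  ∈-subsets {suc n} (false ∷ A) = ∈-++⁺ʳ (map (true ∷_) (subsets n)) (∈-map⁺ (false ∷_) (∈-subsets A))

  f≤∑-subsets : (f : Subset n → ℕ) (A : Subset n) → f A ≤ ∑ (subsets n) (λ U → 𝟙 (A ≟ˢ U) * f U)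
  f≤∑-subsets {n} f A = begin
    f A                                     ≡⟨ +-identityʳ (f A) ⟨
    1 * f A                                 ≡⟨ cong (_* f A) (𝟙-yes (A ≟ˢ A) refl) ⟨
    𝟙 (A ≟ˢ A) * f A                        ≤⟨ f≤∑ (subsets n) (λ U → 𝟙 (A ≟ˢ U) * f U) (∈-subsets A) ⟩
    ∑ (subsets n) (λ U → 𝟙 (A ≟ˢ U) * f U)  ∎
    where open ≤-Reasoning

  -- Groups the list by value and keeps multiplicities: these are at most 1 for a duplicate-free
  -- family, but not for the list of unions of tuples, where they are what has to be estimated.
  ∑≤∑-subsets : (As : List (Subset n)) (f : Subset n → ℕ) →
    ∑ As f ≤ ∑ (subsets n) (λ U → ∑ As (λ A → 𝟙 (A ≟ˢ U)) * f U)
  ∑≤∑-subsets {n} As f = begin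
    ∑ As f
      ≤⟨ ∑-mono As (λ A _ → f≤∑-subsets f A) ⟩
    ∑ As (λ A → ∑ (subsets n) (λ U → 𝟙 (A ≟ˢ U) * f U))
      ≡⟨ ∑-swap As (subsets n) (λ A U → 𝟙 (A ≟ˢ U) * f U) ⟩
    ∑ (subsets n) (λ U → ∑ As (λ A → 𝟙 (A ≟ˢ U) * f U))
      ≡⟨ ∑-cong (subsets n) (λ U → ∑-*ʳ As (f U) (λ A → 𝟙 (A ≟ˢ U))) ⟩
    ∑ (subsets n) (λ U → ∑ As (λ A → 𝟙 (A ≟ˢ U)) * f U) ∎
    where open ≤-Reasoning

  multiplicity≤1 : (As : List (Subset n)) → Unique As → ∀ U → ∑ As (λ A → 𝟙 (A ≟ˢ U)) ≤ 1
  multiplicity≤1 []       _          U = z≤n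
  multiplicity≤1 (A ∷ As) (A∉ ∷ uniq) U with A ≟ˢ U
  ... | no  _    = multiplicity≤1 As uniq U
  ... | yes refl = s≤s (≤-reflexive (absent As A∉))
    where
    absent : ∀ Bs → All (λ B → A ≢ B) Bs → ∑ Bs (λ B → 𝟙 (B ≟ˢ A)) ≡ 0
    absent []       []       = refl
    absent (B ∷ Bs) (≢B ∷ ≢s) = cong₂ _+_ (𝟙-no (B ≟ˢ A) (λ eq → ≢B (sym eq))) (absent Bs ≢s)

  ∑-unique≤∑-subsets : (As : List (Subset n)) → Unique As → (f : Subset n → ℕ) → ∑ As f ≤ ∑ (subsets n) f
  ∑-unique≤∑-subsets {n} As uniq f = begin
    ∑ As f
      ≤⟨ ∑≤∑-subsets As f ⟩
    ∑ (subsets n) (λ U → ∑ As (λ A → 𝟙 (A ≟ˢ U)) * f U)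
      ≤⟨ ∑-mono (subsets n) (λ U _ → *-monoˡ-≤ (f U) (multiplicity≤1 As uniq U)) ⟩
    ∑ (subsets n) (λ U → 1 * f U)
      ≡⟨ ∑-cong (subsets n) (λ U → *-identityˡ (f U)) ⟩
    ∑ (subsets n) f ∎
    where open ≤-Reasoning

  ∏-allFin-suc : (f : Fin (suc n) → ℕ) → ∏ (allFin (suc n)) f ≡ f zero * ∏ (allFin n) (λ x → f (suc x))
  ∏-allFin-suc {n} f = cong (f zero *_)
    (trans (cong (λ xs → ∏ xs f) (sym (map-tabulate {n = n} (λ x → x) suc))) (∏-map suc (allFin n) f))

  ∑-allFin-suc : (f : Fin (suc n) → ℕ) → ∑ (allFin (suc n)) f ≡ f zero + ∑ (allFin n) (λ x → f (suc x))
  ∑-allFin-suc {n} f = cong (f zero +_)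
    (trans (cong (λ xs → ∑ xs f) (sym (map-tabulate {n = n} (λ x → x) suc))) (∑-map suc (allFin n) f))

  weight : (Fin n → Bool → ℕ) → Subset n → ℕ
  weight {n} w A = ∏ (allFin n) (λ x → w x (lookup A x))

  -- Expanding the product of the column sums selects one bit per point, that is, one subset.
  ∑-weight : (w : Fin n → Bool → ℕ) →
    ∑ (subsets n) (weight w) ≡ ∏ (allFin n) (λ x → w x true + w x false)
  ∑-weight {zero}  w = refl
  ∑-weight {suc n} w = begin-equality
    ∑ (map (true ∷_) (subsets n) ++ map (false ∷_) (subsets n)) (weight w)
      ≡⟨ ∑-++ (map (true ∷_) (subsets n)) (map (false ∷_) (subsets n)) (weight w) ⟩
    ∑ (map (true ∷_) (subsets n)) (weight w) + ∑ (map (false ∷_) (subsets n)) (weight w)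
      ≡⟨ cong₂ _+_ (half true) (half false) ⟩
    w zero true * total + w zero false * total
      ≡⟨ *-distribʳ-+ total (w zero true) (w zero false) ⟨
    (w zero true + w zero false) * total
      ≡⟨ ∏-allFin-suc (λ x → w x true + w x false) ⟨
    ∏ (allFin (suc n)) (λ x → w x true + w x false) ∎
    where
    open ≤-Reasoning
    total : ℕ
    total = ∏ (allFin n) (λ x → w (suc x) true + w (suc x) false)
    half : ∀ b → ∑ (map (b ∷_) (subsets n)) (weight w) ≡ w zero b * total
    half b = begin-equality
      ∑ (map (b ∷_) (subsets n)) (weight w)
        ≡⟨ ∑-map (b ∷_) (subsets n) (weight w) ⟩
      ∑ (subsets n) (λ A → weight w (b ∷ A))
        ≡⟨ ∑-cong (subsets n) (λ A → ∏-allFin-suc (λ x → w x (lookup (b ∷ A) x))) ⟩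
      ∑ (subsets n) (λ A → w zero b * weight (λ x → w (suc x)) A)
        ≡⟨ ∑-*ˡ (subsets n) (w zero b) (weight (λ x → w (suc x))) ⟩
      w zero b * ∑ (subsets n) (weight (λ x → w (suc x)))
        ≡⟨ cong (w zero b *_) (∑-weight (λ x → w (suc x))) ⟩
      w zero b * total ∎

  -- The counting tool for both size bounds: if every member of a family weighs at least W, then W
  -- times its size is at most the product of the column sums. `interval-card` and `regular-upper`
  -- choose different `w`.
  ∑-unique-weight : (As : List (Subset n)) → Unique As → (w : Fin n → Bool → ℕ) →
    ∑ As (weight w) ≤ ∏ (allFin n) (λ x → w x true + w x false)
  ∑-unique-weight As uniq w = ≤-trans (∑-unique≤∑-subsets As uniq (weight w)) (≤-reflexive (∑-weight w))

  ∣∣≡∑ : (A : Subset n) → ∣ A ∣ ≡ ∑ (allFin n) (λ x → 𝟙 (x ∈? A))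
  ∣∣≡∑ []       = refl
  ∣∣≡∑ (b ∷ A) = trans (lem b) (sym (∑-allFin-suc (λ x → 𝟙 (x ∈? (b ∷ A)))))
    where
    shift : ∀ b x → 𝟙 (x ∈? A) ≡ 𝟙 (suc x ∈? (b ∷ A))
    shift b x = 𝟙-cong (x ∈? A) (suc x ∈? (b ∷ A)) Vec.there (λ { (Vec.there p) → p })
    lem : ∀ b → ∣ b ∷ A ∣ ≡ 𝟙 (zero ∈? (b ∷ A)) + ∑ (allFin _) (λ x → 𝟙 (suc x ∈? (b ∷ A)))
    lem true  = cong suc (trans (∣∣≡∑ A) (∑-cong (allFin _) (shift true)))
    lem false = trans (∣∣≡∑ A) (∑-cong (allFin _) (shift false))

  lookup≡true : {A : Subset n} {x : Fin n} → x ∈ˢ A → lookup A x ≡ true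
  lookup≡true = []=⇒lookup

  lookup≡false : {A : Subset n} {x : Fin n} → ¬ x ∈ˢ A → lookup A x ≡ false
  lookup≡false {A = A} {x} x∉A with lookup A x in eq
  ... | true  = contradiction (lookup⇒[]= x A eq) x∉A
  ... | false = refl

  -- The bit x contributes 2^[x∈U] · (number of admissible bits) ≤ 2^[x∈Y], whatever its status in U and Y.
  interval-card : (As : List (Subset n)) → Unique As → (U Y : Subset n) →
    ∑ As (λ A → 𝟙 ((U ⊆? A) ×-dec (A ⊆? Y))) * 2 ^ ∣ U ∣ ≤ 2 ^ ∣ Y ∣
  interval-card {n} As uniq U Y = begin
    ∑ As (λ A → 𝟙 ((U ⊆? A) ×-dec (A ⊆? Y))) * 2 ^ ∣ U ∣
      ≤⟨ *-monoˡ-≤ (2 ^ ∣ U ∣) (∑-mono As (λ A _ → inside-weight A)) ⟩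
    ∑ As (weight w) * 2 ^ ∣ U ∣
      ≤⟨ *-mono-≤ (∑-unique-weight As uniq w) (≤-reflexive (pow U)) ⟩
    ∏ (allFin n) (λ x → w x true + w x false) * ∏ (allFin n) (λ x → 2 ^ 𝟙 (x ∈? U))
      ≡⟨ ∏-* (allFin n) (λ x → w x true + w x false) (λ x → 2 ^ 𝟙 (x ∈? U)) ⟨
    ∏ (allFin n) (λ x → (w x true + w x false) * 2 ^ 𝟙 (x ∈? U))
      ≤⟨ ∏-mono (allFin n) (λ x _ → column x) ⟩
    ∏ (allFin n) (λ x → 2 ^ 𝟙 (x ∈? Y))
      ≡⟨ pow Y ⟨
    2 ^ ∣ Y ∣ ∎
    where
    open ≤-Reasoning
    w : Fin n → Bool → ℕ
    w x true  = 𝟙 (x ∈? Y)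
    w x false = 𝟙 (¬? (x ∈? U))
    pow : ∀ A → 2 ^ ∣ A ∣ ≡ ∏ (allFin n) (λ x → 2 ^ 𝟙 (x ∈? A))
    pow A = trans (cong (2 ^_) (∣∣≡∑ A)) (sym (∏-^ (allFin n) 2 (λ x → 𝟙 (x ∈? A))))
    column : ∀ x → (w x true + w x false) * 2 ^ 𝟙 (x ∈? U) ≤ 2 ^ 𝟙 (x ∈? Y)
    column x with x ∈? U | x ∈? Y
    ... | yes _ | yes _ = ≤-refl
    ... | yes _ | no  _ = z≤n
    ... | no  _ | yes _ = ≤-refl
    ... | no  _ | no  _ = ≤-refl
    inside-weight : ∀ A → 𝟙 ((U ⊆? A) ×-dec (A ⊆? Y)) ≤ weight w A
    inside-weight A with (U ⊆? A) ×-dec (A ⊆? Y)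
    ... | no _ = z≤n
    ... | yes (U⊆A , A⊆Y) = ≤-trans (≤-reflexive (sym (trans (∏-const (allFin n) 1) (^-zeroˡ (length (allFin n))))))
                                    (∏-mono (allFin n) (λ x _ → bit x))
      where
      bit : ∀ x → 1 ≤ w x (lookup A x)
      bit x with x ∈? A
      ... | yes x∈A rewrite lookup≡true x∈A = ≤-reflexive (sym (𝟙-yes (x ∈? Y) (A⊆Y x∈A)))
      ... | no  x∉A rewrite lookup≡false x∉A = ≤-reflexive (sym (𝟙-yes (¬? (x ∈? U)) (λ x∈U → x∉A (U⊆A x∈U))))

  -- Rich levels

  ^-distribʳ-* : ∀ x y t → (x * y) ^ t ≡ x ^ t * y ^ t
  ^-distribʳ-* x y zero    = refl
  ^-distribʳ-* x y (suc t) = trans (cong (x * y *_) (^-distribʳ-* x y t)) (*-interchange x y (x ^ t) (y ^ t))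

  2^-cancel-≤ : ∀ {x y} → 2 ^ x ≤ 2 ^ y → x ≤ y
  2^-cancel-≤ {x} {y} le with x ≤? y
  ... | yes x≤y = x≤y
  ... | no  x≰y = contradiction le (<⇒≱ (^-monoʳ-< 2 (s≤s (s≤s z≤n)) (≰⇒> x≰y)))

  module Levels {n : ℕ} (F : List (Subset n)) (b : ℕ) where

    m : ℕ
    m = length F

    Level  : ℕ → Subset n → Set
    level? : ∀ r A → Dec (Level r A)
    below  : ℕ → Subset n → ℕ

    Level zero    A = Unit
    Level (suc r) A = Level r A × m ≤ b * below r A

    level? zero    A = yes tt
    level? (suc r) A = level? r A ×-dec (m ≤? b * below r A)

    below r Y = ∑ F (λ B → 𝟙 (level? r B ×-dec (B ⊆? Y)))

    ∑F≤m : (f : Subset n → ℕ) → (∀ A → f A ≤ 1) → ∑ F f ≤ m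
    ∑F≤m f f≤1 = ≤-trans (∑-mono F (λ A _ → f≤1 A)) (≤-reflexive (trans (∑-const F 1) (*-identityʳ m)))

    below≤m : ∀ r Y → below r Y ≤ m
    below≤m r Y = ∑F≤m _ (λ B → 𝟙≤1 (level? r B ×-dec (B ⊆? Y)))

    between : Subset n → Subset n → ℕ
    between U Y = ∑ F (λ A → 𝟙 ((U ⊆? A) ×-dec (A ⊆? Y)))

    -- One entry per t-tuple of level-r members, with repetitions kept, so that counting entries
    -- counts tuples.
    unions : ℕ → ℕ → List (Subset n)
    unions r zero    = ⊥ ∷ []
    unions r (suc t) = cartesianProductWith _∪_ (filter (level? r) F) (unions r t)

    -- A union lies in `B` exactly when every component does, so the t components are chosen
    -- independently among the level-r sets below `B`.
    ∑-unions-⊆ : ∀ r t B → ∑ (unions r t) (λ V → 𝟙 (V ⊆? B)) ≡ below r B ^ t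
    ∑-unions-⊆ r zero    B = cong (_+ 0) (𝟙-yes (⊥ ⊆? B) ⊥⊆)
    ∑-unions-⊆ r (suc t) B = begin-equality
      ∑ (unions r (suc t)) (λ V → 𝟙 (V ⊆? B))
        ≡⟨ ∑-cartesianProductWith _∪_ (filter (level? r) F) (unions r t) (λ V → 𝟙 (V ⊆? B)) ⟩
      ∑ (filter (level? r) F) (λ C → ∑ (unions r t) (λ V → 𝟙 ((C ∪ V) ⊆? B)))
        ≡⟨ ∑-cong (filter (level? r) F) (λ C → ∑-cong (unions r t) (λ V → split C V)) ⟩
      ∑ (filter (level? r) F) (λ C → ∑ (unions r t) (λ V → 𝟙 (C ⊆? B) * 𝟙 (V ⊆? B)))
        ≡⟨ ∑-∑-* (filter (level? r) F) (unions r t) (λ C → 𝟙 (C ⊆? B)) (λ V → 𝟙 (V ⊆? B)) ⟩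
      ∑ (filter (level? r) F) (λ C → 𝟙 (C ⊆? B)) * ∑ (unions r t) (λ V → 𝟙 (V ⊆? B))
        ≡⟨ cong₂ _*_ members (∑-unions-⊆ r t B) ⟩
      below r B ^ suc t ∎
      where
      open ≤-Reasoning
      split : ∀ C V → 𝟙 ((C ∪ V) ⊆? B) ≡ 𝟙 (C ⊆? B) * 𝟙 (V ⊆? B)
      split C V = 𝟙-* (C ⊆? B) (V ⊆? B) ((C ∪ V) ⊆? B)
        (λ C⊆B V⊆B x∈ → [ (λ p → C⊆B p) , (λ p → V⊆B p) ] (x∈p∪q⁻ C V x∈))
        (λ C∪V⊆B → (λ x∈ → C∪V⊆B (p⊆p∪q V x∈)) , (λ x∈ → C∪V⊆B (q⊆p∪q C V x∈)))
      members : ∑ (filter (level? r) F) (λ C → 𝟙 (C ⊆? B)) ≡ below r B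
      members = trans (∑-filter (level? r) F (λ C → 𝟙 (C ⊆? B)))
        (∑-cong F (λ C → sym (𝟙-* (level? r C) (C ⊆? B) (level? r C ×-dec (C ⊆? B)) _,_ (λ p → p))))

    length-unions : ∀ r t → length (unions r t) ≤ m ^ t
    length-unions r t = begin
      length (unions r t)                    ≡⟨ trans (∑-const (unions r t) 1) (*-identityʳ _) ⟨
      ∑ (unions r t) (λ V → 1)               ≡⟨ ∑-cong (unions r t) (λ V → sym (𝟙-yes (V ⊆? ⊤) ⊆⊤)) ⟩
      ∑ (unions r t) (λ V → 𝟙 (V ⊆? ⊤))      ≡⟨ ∑-unions-⊆ r t ⊤ ⟩
      below r ⊤ ^ t                          ≤⟨ ^-monoˡ-≤ t (below≤m r ⊤) ⟩
      m ^ t ∎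
      where open ≤-Reasoning

    -- A tuple with union `U` consists of sets below `U`; if `U` is rare, there are at most (m /
    -- 2^e)^t such tuples. Summing over all 2^n candidates for `U` gives the bound.
    rare-unions : ∀ r e t →
      2 ^ (e * t) * ∑ (unions r t) (λ V → 𝟙 (¬? (m ≤? 2 ^ e * below r V))) ≤ 2 ^ n * m ^ t
    rare-unions r e t = begin
      2 ^ (e * t) * ∑ (unions r t) rare
        ≤⟨ *-monoʳ-≤ (2 ^ (e * t)) (∑≤∑-subsets (unions r t) rare) ⟩
      2 ^ (e * t) * ∑ (subsets n) (λ U → ∑ (unions r t) (λ V → 𝟙 (V ≟ˢ U)) * rare U)
        ≡⟨ ∑-*ˡ (subsets n) (2 ^ (e * t)) _ ⟨
      ∑ (subsets n) (λ U → 2 ^ (e * t) * (∑ (unions r t) (λ V → 𝟙 (V ≟ˢ U)) * rare U))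
        ≤⟨ ∑-mono (subsets n) (λ U _ → term U) ⟩
      ∑ (subsets n) (λ U → m ^ t)
        ≡⟨ trans (∑-const (subsets n) (m ^ t)) (cong (_* m ^ t) (length-subsets n)) ⟩
      2 ^ n * m ^ t ∎
      where
      open ≤-Reasoning
      rare : Subset n → ℕ
      rare V = 𝟙 (¬? (m ≤? 2 ^ e * below r V))
      term : ∀ U → 2 ^ (e * t) * (∑ (unions r t) (λ V → 𝟙 (V ≟ˢ U)) * rare U) ≤ m ^ t
      term U with ¬? (m ≤? 2 ^ e * below r U)
      ... | no _ = ≤-trans (≤-reflexive (trans (cong (2 ^ (e * t) *_) (*-zeroʳ (∑ (unions r t) (λ V → 𝟙 (V ≟ˢ U))))) (*-zeroʳ (2 ^ (e * t))))) z≤n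
      ... | yes h<m = begin
        2 ^ (e * t) * (∑ (unions r t) (λ V → 𝟙 (V ≟ˢ U)) * 1)
          ≡⟨ cong (2 ^ (e * t) *_) (*-identityʳ _) ⟩
        2 ^ (e * t) * ∑ (unions r t) (λ V → 𝟙 (V ≟ˢ U))
          ≤⟨ *-monoʳ-≤ (2 ^ (e * t)) (∑-mono (unions r t) (λ V _ → 𝟙-mono (V ≟ˢ U) (V ⊆? U) (λ { refl → ⊆-refl }))) ⟩
        2 ^ (e * t) * ∑ (unions r t) (λ V → 𝟙 (V ⊆? U))
          ≡⟨ cong₂ _*_ (sym (^-*-assoc 2 e t)) (∑-unions-⊆ r t U) ⟩
        (2 ^ e) ^ t * below r U ^ t
          ≡⟨ ^-distribʳ-* (2 ^ e) (below r U) t ⟨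
        (2 ^ e * below r U) ^ t
          ≤⟨ ^-monoˡ-≤ t (<⇒≤ (≰⇒> h<m)) ⟩
        m ^ t ∎

    -- Counting pairs (B, t-tuple of level-r sets below B) according to the union V of the tuple:
    -- few tuples have a union lying above few level-r sets, because there are only 2^n unions.
    descend : ∀ r e t c Y → 0 < m → n + suc c ≤ e * t → 2 ^ c ≡ 2 * (2 ^ e * b ^ t) →
      m ≤ 2 ^ e * below (suc r) Y →
      ∃ λ U → m ≤ 2 ^ e * below r U × m ≤ 2 ^ c * between U Y
    descend r e t c Y 0<m n+c<et c≡ large
      with any? (λ V → (m ≤? 2 ^ e * below r V) ×-dec (m ≤? 2 ^ c * between V Y)) (unions r t)
    ... | yes found = let V , _ , good = find found in V , good
    ... | no none = contradiction four≤three (<⇒≱ (*-monoˡ-< (m * m ^ t) {{>-nonZero (*-mono-≤ 0<m (m^n>0 m {{>-nonZero 0<m}} t))}} (n<1+n 3)))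
      where
      open ≤-Reasoning
      top? : ∀ B → Dec (Level (suc r) B × B ⊆ Y)
      top? B = level? (suc r) B ×-dec (B ⊆? Y)
      rare : Subset n → ℕ
      rare V = 𝟙 (¬? (m ≤? 2 ^ e * below r V))
      N : ℕ
      N = ∑ F (λ B → 𝟙 (top? B) * ∑ (unions r t) (λ V → 𝟙 (V ⊆? B)))
      lower-term : ∀ B → 𝟙 (top? B) * m ^ t ≤ b ^ t * (𝟙 (top? B) * ∑ (unions r t) (λ V → 𝟙 (V ⊆? B)))
      lower-term B with top? B
      ... | no  _ = z≤n
      ... | yes ((_ , m≤) , _) = begin
        1 * m ^ t                                                  ≡⟨ *-identityˡ (m ^ t) ⟩
        m ^ t                                                      ≤⟨ ^-monoˡ-≤ t m≤ ⟩
        (b * below r B) ^ t                                        ≡⟨ ^-distribʳ-* b (below r B) t ⟩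
        b ^ t * below r B ^ t                                      ≡⟨ cong (b ^ t *_) (trans (sym (∑-unions-⊆ r t B)) (sym (*-identityˡ _))) ⟩
        b ^ t * (1 * ∑ (unions r t) (λ V → 𝟙 (V ⊆? B)))            ∎
      lower : m * m ^ t ≤ 2 ^ e * b ^ t * N
      lower = begin
        m * m ^ t                                     ≤⟨ *-monoˡ-≤ (m ^ t) large ⟩
        2 ^ e * below (suc r) Y * m ^ t               ≡⟨ *-assoc (2 ^ e) _ _ ⟩
        2 ^ e * (below (suc r) Y * m ^ t)             ≡⟨ cong (2 ^ e *_) (sym (∑-*ʳ F (m ^ t) (λ B → 𝟙 (top? B)))) ⟩
        2 ^ e * ∑ F (λ B → 𝟙 (top? B) * m ^ t)        ≤⟨ *-monoʳ-≤ (2 ^ e) (∑-mono F (λ B _ → lower-term B)) ⟩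
        2 ^ e * ∑ F (λ B → b ^ t * (𝟙 (top? B) * ∑ (unions r t) (λ V → 𝟙 (V ⊆? B))))
                                                      ≡⟨ cong (2 ^ e *_) (∑-*ˡ F (b ^ t) _) ⟩
        2 ^ e * (b ^ t * N)                           ≡⟨ *-assoc (2 ^ e) (b ^ t) N ⟨
        2 ^ e * b ^ t * N                             ∎
      upper-N : N ≤ ∑ (unions r t) (λ V → between V Y)
      upper-N = begin
        N
          ≡⟨ ∑-cong F (λ B → sym (∑-*ˡ (unions r t) (𝟙 (top? B)) _)) ⟩
        ∑ F (λ B → ∑ (unions r t) (λ V → 𝟙 (top? B) * 𝟙 (V ⊆? B)))
          ≡⟨ ∑-swap F (unions r t) _ ⟩
        ∑ (unions r t) (λ V → ∑ F (λ B → 𝟙 (top? B) * 𝟙 (V ⊆? B)))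
          ≤⟨ ∑-mono (unions r t) (λ V _ → ∑-mono F (λ B _ → pair V B)) ⟩
        ∑ (unions r t) (λ V → between V Y) ∎
        where
        pair : ∀ V B → 𝟙 (top? B) * 𝟙 (V ⊆? B) ≤ 𝟙 ((V ⊆? B) ×-dec (B ⊆? Y))
        pair V B = ≤-trans (≤-reflexive (sym (𝟙-* (top? B) (V ⊆? B) (top? B ×-dec (V ⊆? B)) _,_ (λ p → p))))
          (𝟙-mono (top? B ×-dec (V ⊆? B)) ((V ⊆? B) ×-dec (B ⊆? Y)) (λ { ((_ , B⊆Y) , V⊆B) → V⊆B , B⊆Y }))
      upper-term : ∀ V → V ∈ unions r t → 2 ^ c * between V Y ≤ 2 ^ c * m * rare V + m
      upper-term V V∈ with m ≤? 2 ^ e * below r V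
      ... | no _ = begin
        2 ^ c * between V Y ≤⟨ *-monoʳ-≤ (2 ^ c) (∑F≤m _ (λ A → 𝟙≤1 ((V ⊆? A) ×-dec (A ⊆? Y)))) ⟩
        2 ^ c * m           ≡⟨ *-identityʳ _ ⟨
        2 ^ c * m * 1       ≤⟨ m≤m+n _ m ⟩
        2 ^ c * m * 1 + m   ∎
      ... | yes m≤h with m ≤? 2 ^ c * between V Y
      ...   | yes m≤ = contradiction (lose V∈ (m≤h , m≤)) none
      ...   | no  ≰  = ≤-trans (<⇒≤ (≰⇒> ≰)) (m≤n+m m _)
      upper : 2 ^ c * N ≤ 2 ^ c * m * ∑ (unions r t) rare + m ^ t * m
      upper = begin
        2 ^ c * N                                              ≤⟨ *-monoʳ-≤ (2 ^ c) upper-N ⟩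
        2 ^ c * ∑ (unions r t) (λ V → between V Y)             ≡⟨ ∑-*ˡ (unions r t) (2 ^ c) _ ⟨
        ∑ (unions r t) (λ V → 2 ^ c * between V Y)             ≤⟨ ∑-mono (unions r t) upper-term ⟩
        ∑ (unions r t) (λ V → 2 ^ c * m * rare V + m)          ≡⟨ ∑-+ (unions r t) _ _ ⟩
        ∑ (unions r t) (λ V → 2 ^ c * m * rare V) + ∑ (unions r t) (λ V → m)
          ≡⟨ cong₂ _+_ (∑-*ˡ (unions r t) (2 ^ c * m) rare) (∑-const (unions r t) m) ⟩
        2 ^ c * m * ∑ (unions r t) rare + length (unions r t) * m
          ≤⟨ +-monoʳ-≤ (2 ^ c * m * ∑ (unions r t) rare) (*-monoˡ-≤ m (length-unions r t)) ⟩
        2 ^ c * m * ∑ (unions r t) rare + m ^ t * m            ∎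
      few-rare : 2 * 2 ^ c * ∑ (unions r t) rare ≤ m ^ t
      few-rare = *-cancelˡ-≤ (2 ^ n) {{m^n≢0 2 n}} (begin
        2 ^ n * (2 * 2 ^ c * ∑ (unions r t) rare)   ≡⟨ *-assoc (2 ^ n) (2 ^ suc c) _ ⟨
        2 ^ n * 2 ^ suc c * ∑ (unions r t) rare     ≡⟨ cong (_* ∑ (unions r t) rare) (^-distribˡ-+-* 2 n (suc c)) ⟨
        2 ^ (n + suc c) * ∑ (unions r t) rare       ≤⟨ *-monoˡ-≤ _ (^-monoʳ-≤ 2 n+c<et) ⟩
        2 ^ (e * t) * ∑ (unions r t) rare           ≤⟨ rare-unions r e t ⟩
        2 ^ n * m ^ t                               ∎)
      -- Measured in units of m · m^t / 2^c: `lower` makes N at least 2, as 2^c is twice 2^e b^t. If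
      -- no good union exists, the rare unions account for at most 1/2 (this is what
      -- `n + suc c ≤ e * t` buys) and the others for at most 1.
      four≤three : 4 * (m * m ^ t) ≤ 3 * (m * m ^ t)
      four≤three = begin
        4 * (m * m ^ t)                                   ≤⟨ *-monoʳ-≤ 4 lower ⟩
        4 * (2 ^ e * b ^ t * N)                           ≡⟨ regroup (2 ^ e * b ^ t) N ⟩
        2 * (2 * (2 ^ e * b ^ t) * N)                     ≡⟨ cong (λ z → 2 * (z * N)) c≡ ⟨
        2 * (2 ^ c * N)                                   ≤⟨ *-monoʳ-≤ 2 upper ⟩
        2 * (2 ^ c * m * ∑ (unions r t) rare + m ^ t * m) ≡⟨ regroup′ (2 ^ c) m (∑ (unions r t) rare) (m ^ t) ⟩
        m * (2 * 2 ^ c * ∑ (unions r t) rare) + 2 * (m * m ^ t)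
          ≤⟨ +-monoˡ-≤ (2 * (m * m ^ t)) (*-monoʳ-≤ m few-rare) ⟩
        m * m ^ t + 2 * (m * m ^ t)                       ∎
        where
        regroup : ∀ x y → 4 * (x * y) ≡ 2 * (2 * x * y)
        regroup = solve-∀
        regroup′ : ∀ x y z w → 2 * (x * y * z + w * y) ≡ y * (2 * x * z) + 2 * (y * w)
        regroup′ = solve-∀

  module _ {n : ℕ} (F : List (Subset n)) (b : ℕ) where
    open Levels F b

    -- [U, Y] contains at least m / 2^x ≥ 2^(d - x) distinct sets, hence has dimension at least d -
    -- x.
    dimension-gap : Unique F → ∀ d x U Y → 2 ^ d ≤ m → m ≤ 2 ^ x * between U Y → d + ∣ U ∣ ≤ x + ∣ Y ∣
    dimension-gap uniq d x U Y 2^d≤m m≤ = 2^-cancel-≤ (begin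
      2 ^ (d + ∣ U ∣)                    ≡⟨ ^-distribˡ-+-* 2 d ∣ U ∣ ⟩
      2 ^ d * 2 ^ ∣ U ∣                  ≤⟨ *-monoˡ-≤ (2 ^ ∣ U ∣) (≤-trans 2^d≤m m≤) ⟩
      2 ^ x * between U Y * 2 ^ ∣ U ∣    ≡⟨ *-assoc (2 ^ x) (between U Y) (2 ^ ∣ U ∣) ⟩
      2 ^ x * (between U Y * 2 ^ ∣ U ∣)  ≤⟨ *-monoʳ-≤ (2 ^ x) (interval-card F uniq U Y) ⟩
      2 ^ x * 2 ^ ∣ Y ∣                  ≡⟨ ^-distribˡ-+-* 2 x ∣ Y ∣ ⟨
      2 ^ (x + ∣ Y ∣)                    ∎)
      where open ≤-Reasoning

    -- Induction on `r`: `descend` supplies a set `U` that is again large one level lower, and the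
    -- interval [U, Y] adds d - c to the dimension. At level 0, `below` counts [∅, Y] itself, which
    -- costs only e ≤ c.
    level-size : Unique F → ∀ d e t c → 2 ^ d ≤ m → e ≤ c → n + suc c ≤ e * t → 2 ^ c ≡ 2 * (2 ^ e * b ^ t) →
      ∀ r Y → m ≤ 2 ^ e * below r Y → suc r * d ≤ ∣ Y ∣ + suc r * c
    level-size uniq d e t c 2^d≤m e≤c n+c<et c≡ zero Y large = begin
      d + 0                ≡⟨ +-identityʳ d ⟩
      d                    ≤⟨ m≤m+n d ∣ ⊥ {n} ∣ ⟩
      d + ∣ ⊥ {n} ∣        ≤⟨ dimension-gap uniq d e ⊥ Y 2^d≤m (≤-trans large (*-monoʳ-≤ (2 ^ e) below≤between)) ⟩
      e + ∣ Y ∣            ≤⟨ +-monoˡ-≤ ∣ Y ∣ e≤c ⟩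
      c + ∣ Y ∣            ≡⟨ +-comm c ∣ Y ∣ ⟩
      ∣ Y ∣ + c            ≡⟨ cong (∣ Y ∣ +_) (+-identityʳ c) ⟨
      ∣ Y ∣ + (c + 0)      ∎
      where
      open ≤-Reasoning
      below≤between : below 0 Y ≤ between ⊥ Y
      below≤between = ∑-mono F (λ B _ → 𝟙-mono (level? 0 B ×-dec (B ⊆? Y)) ((⊥ ⊆? B) ×-dec (B ⊆? Y)) (λ { (_ , B⊆Y) → ⊥⊆ , B⊆Y }))
    level-size uniq d e t c 2^d≤m e≤c n+c<et c≡ (suc r) Y large =
      let U , below-U , between-U = descend r e t c Y (≤-trans (m^n>0 2 d) 2^d≤m) n+c<et c≡ large
      in begin
      d + suc r * d                  ≤⟨ +-monoʳ-≤ d (level-size uniq d e t c 2^d≤m e≤c n+c<et c≡ r U below-U) ⟩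
      d + (∣ U ∣ + suc r * c)        ≡⟨ +-assoc d ∣ U ∣ _ ⟨
      d + ∣ U ∣ + suc r * c          ≤⟨ +-monoˡ-≤ (suc r * c) (dimension-gap uniq d c U Y 2^d≤m between-U) ⟩
      c + ∣ Y ∣ + suc r * c          ≡⟨ cong (_+ suc r * c) (+-comm c ∣ Y ∣) ⟩
      ∣ Y ∣ + c + suc r * c          ≡⟨ +-assoc ∣ Y ∣ c (suc r * c) ⟩
      ∣ Y ∣ + (c + suc r * c)        ∎
      where open ≤-Reasoning

    -- Otherwise `level-size` applies to r = k and Y = [n], because b ≤ 2^e, and (k + 1) d ≤ k d +
    -- (k + 1) c contradicts (k + 1) c < d.
    few-at-level : Unique F → ∀ k d e t c → n ≡ k * d → 2 ^ d ≤ m → b ≤ 2 ^ e → e ≤ c → n + suc c ≤ e * t →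
      2 ^ c ≡ 2 * (2 ^ e * b ^ t) → suc k * c < d → b * below k ⊤ ≤ m
    few-at-level uniq k d e t c n≡kd 2^d≤m b≤ e≤c n+c<et c≡ c<d with m ≤? b * below k ⊤
    ... | no  ≰ = <⇒≤ (≰⇒> ≰)
    ... | yes large = contradiction c<d (≤⇒≯ (+-cancelʳ-≤ (k * d) d (suc k * c) (begin
      d + k * d                ≤⟨ level-size uniq d e t c 2^d≤m e≤c n+c<et c≡ k ⊤ (≤-trans large (*-monoˡ-≤ (below k ⊤) b≤)) ⟩
      ∣ ⊤ {n} ∣ + suc k * c    ≡⟨ cong (_+ suc k * c) (trans (∣⊤∣≡n n) n≡kd) ⟩
      k * d + suc k * c        ≡⟨ +-comm (k * d) (suc k * c) ⟩
      suc k * c + k * d        ∎)))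
      where open ≤-Reasoning

    rank : ℕ → Subset n → ℕ
    rank zero    A = zero
    rank (suc r) A with level? (suc r) A
    ... | yes _ = suc r
    ... | no  _ = rank r A

    rank≤ : ∀ r A → rank r A ≤ r
    rank≤ zero    A = z≤n
    rank≤ (suc r) A with level? (suc r) A
    ... | yes _ = ≤-refl
    ... | no  _ = m≤n⇒m≤1+n (rank≤ r A)

    rank-level : ∀ r A → Level (rank r A) A
    rank-level zero    A = tt
    rank-level (suc r) A with level? (suc r) A
    ... | yes l = l
    ... | no  _ = rank-level r A

    rank-maximal : ∀ r A {j} → rank r A < j → j ≤ r → ¬ Level j A
    rank-maximal zero    A rank<j j≤r l = <⇒≱ rank<j j≤r
    rank-maximal (suc r) A {j} rank<j j≤r l with level? (suc r) A
    ... | yes _ = <⇒≱ rank<j j≤r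
    ... | no ¬l with m≤n⇒m<n∨m≡n j≤r
    ...   | inj₁ (s≤s j≤) = rank-maximal r A rank<j j≤ l
    ...   | inj₂ refl     = ¬l l

    level-antitone : ∀ {i j} A → i ≤′ j → Level j A → Level i A
    level-antitone A ≤′-refl        l = l
    level-antitone A (≤′-step i≤j) (l , _) = level-antitone A i≤j l

    -- Otherwise `A` would reach the level after its rank: levels are nested, so all sets of at
    -- least this rank belong to level `rank k A`. The bound covers inclusions inside a class and
    -- inclusions against the rank order at once.
    few-below : ∀ k A → rank k A < k → b * ∑ F (λ B → 𝟙 ((rank k A ≤? rank k B) ×-dec (B ⊆? A))) ≤ m
    few-below k A rank<k with m ≤? b * below (rank k A) A
    ... | yes large = contradiction (rank-level k A , large) (rank-maximal k A (n<1+n _) rank<k)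
    ... | no  small = ≤-trans (*-monoʳ-≤ b (∑-mono F (λ B _ → 𝟙-mono ((rank k A ≤? rank k B) ×-dec (B ⊆? A))
        (level? (rank k A) B ×-dec (B ⊆? A)) (λ { (≤rank , B⊆A) → level-antitone B (≤⇒≤′ ≤rank) (rank-level k B) , B⊆A }))))
        (<⇒≤ (≰⇒> small))

    few-top : ∀ k → b * below k ⊤ ≤ m → b * ∑ F (λ A → 𝟙 (rank k A ≟ k)) ≤ m
    few-top k few = ≤-trans (*-monoʳ-≤ b (∑-mono F (λ A _ → 𝟙-mono (rank k A ≟ k) (level? k A ×-dec (A ⊆? ⊤))
        (λ eq → subst (λ r → Level r A) eq (rank-level k A) , ⊆⊤)))) few

  -- Level sizes and comparabilities across levels

  ∑-𝟙≟ : ∀ k a → ∑ (allFin k) (λ i → 𝟙 (a ≟ toℕ i)) ≡ 𝟙 (a <? k)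
  ∑-𝟙≟ zero    a       = sym (𝟙-no (a <? 0) (λ ()))
  ∑-𝟙≟ (suc k) zero    = trans (∑-allFin-suc {n = k} (λ i → 𝟙 (0 ≟ toℕ i)))
    (trans (cong (1 +_) (∑-zero (allFin k))) (sym (𝟙-yes (0 <? suc k) (s≤s z≤n))))
  ∑-𝟙≟ (suc k) (suc a) = trans (∑-allFin-suc {n = k} (λ i → 𝟙 (suc a ≟ toℕ i)))
    (trans (∑-cong (allFin k) (λ i → 𝟙-cong (suc a ≟ suc (toℕ i)) (a ≟ toℕ i) suc-injective (cong suc)))
    (trans (∑-𝟙≟ k a) (𝟙-cong (a <? k) (suc a <? suc k) s≤s s≤s⁻¹)))

  -- Each comparable pair is charged to its larger member. The diagonal of the double sum is
  -- surplus, which is harmless for an upper bound.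
  comparablePairs≤ : ∀ {n} (F : List (Subset n)) → comparablePairs F ≤ ∑ F (λ A → ∑ F (λ B → 𝟙 (B ⊆? A)))
  comparablePairs≤ []      = z≤n
  comparablePairs≤ (A ∷ F) = begin
    length (filter (comparable? A) F) + comparablePairs F
      ≤⟨ +-mono-≤ first (comparablePairs≤ F) ⟩
    (∑ F (λ B → 𝟙 (B ⊆? A)) + ∑ F (λ B → 𝟙 (A ⊆? B))) + ∑ F (λ C → ∑ F (λ B → 𝟙 (B ⊆? C)))
      ≡⟨ +-assoc (∑ F (λ B → 𝟙 (B ⊆? A))) _ _ ⟩
    ∑ F (λ B → 𝟙 (B ⊆? A)) + (∑ F (λ B → 𝟙 (A ⊆? B)) + ∑ F (λ C → ∑ F (λ B → 𝟙 (B ⊆? C))))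
      ≤⟨ +-mono-≤ (m≤n+m _ (𝟙 (A ⊆? A))) (≤-reflexive (sym (∑-+ F (λ C → 𝟙 (A ⊆? C)) _))) ⟩
    ∑ (A ∷ F) (λ B → 𝟙 (B ⊆? A)) + ∑ F (λ C → ∑ (A ∷ F) (λ B → 𝟙 (B ⊆? C))) ∎
    where
    open ≤-Reasoning
    first : length (filter (comparable? A) F) ≤ ∑ F (λ B → 𝟙 (B ⊆? A)) + ∑ F (λ B → 𝟙 (A ⊆? B))
    first = begin
      length (filter (comparable? A) F)         ≡⟨ length-filter (comparable? A) F ⟩
      ∑ F (λ B → 𝟙 (comparable? A B))           ≤⟨ ∑-mono F (λ B _ → 𝟙-cover (comparable? A B) (B ⊆? A) (A ⊆? B)
                                                     (λ { (inj₁ A⊆B) → inj₂ A⊆B ; (inj₂ B⊆A) → inj₁ B⊆A })) ⟩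
      ∑ F (λ B → 𝟙 (B ⊆? A) + 𝟙 (A ⊆? B))       ≡⟨ ∑-+ F _ _ ⟩
      ∑ F (λ B → 𝟙 (B ⊆? A)) + ∑ F (λ B → 𝟙 (A ⊆? B)) ∎

  ∣-∣-square : ∀ x y → ∣ x - y ∣ * ∣ x - y ∣ + 2 * (x * y) ≡ x * x + y * y
  ∣-∣-square zero    y       = +-identityʳ (y * y)
  ∣-∣-square (suc x) zero    = cong (suc x * suc x +_) (cong (2 *_) (*-zeroʳ (suc x)))
  ∣-∣-square (suc x) (suc y) = trans (shift (∣ x - y ∣ * ∣ x - y ∣) x y)
    (trans (cong (_+ 2 * (x + y + 1)) (∣-∣-square x y)) (unshift x y))
    where
    shift : ∀ q x y → q + 2 * (suc x * suc y) ≡ q + 2 * (x * y) + 2 * (x + y + 1)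
    shift = solve-∀
    unshift : ∀ x y → x * x + y * y + 2 * (x + y + 1) ≡ suc x * suc x + suc y * suc y
    unshift = solve-∀

  -- The hypotheses scaled so that all terms except those of the conclusion cancel.
  combine : ∀ k H b m p c D Z W s v Δ →
    b * (c + D) ≤ b * Z + 2 * (m * m) →
    2 * Z + W ≤ m * m →
    m ≤ s + v → b * v ≤ m →
    Δ + 2 * (k * m * s) ≡ k * k * W + k * (m * m) →
    k * H * p ≤ 2 * (k * H * c) + suc H * p →
    p + m ≡ m * m →
    H * b * (Δ + 2 * (k * k) * D) ≤ 4 * H * (k * k) * (m * m) + 2 * k * H * (m * m) + b * k * (m * m) + b * (k * k) * H * m
  combine k H b m p c D Z W s v Δ h1 h2 h3 h4 h5 h6 h7 =
    +-cancelʳ-≤ common _ _ (begin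
      H * b * (Δ + 2 * (k * k) * D) + common
        ≡⟨ left k H b m p c D Z W s v Δ ⟩
      2 * H * (k * k) * (b * (c + D)) + (H * b * (k * k) * (2 * Z + W) + (H * b * (Δ + 2 * (k * m * s)) + (2 * k * m * H * b * m
        + (2 * k * m * H * (b * v) + (b * k * (k * H * p) + (b * (k * k) * H * (m * m) + b * k * suc H * p))))))
        ≤⟨ +-mono-≤ (*-monoʳ-≤ (2 * H * (k * k)) h1) (+-mono-≤ (*-monoʳ-≤ (H * b * (k * k)) h2)
           (+-mono-≤ (*-monoʳ-≤ (H * b) (≤-reflexive h5)) (+-mono-≤ (*-monoʳ-≤ (2 * k * m * H * b) h3)
           (+-mono-≤ (*-monoʳ-≤ (2 * k * m * H) h4) (+-mono-≤ (*-monoʳ-≤ (b * k) h6)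
           (+-mono-≤ (*-monoʳ-≤ (b * (k * k) * H) (≤-reflexive (sym h7))) (*-monoʳ-≤ (b * k * suc H) (m+n≤o⇒m≤o p (≤-reflexive h7))))))))) ⟩
      2 * H * (k * k) * (b * Z + 2 * (m * m)) + (H * b * (k * k) * (m * m) + (H * b * (k * k * W + k * (m * m)) + (2 * k * m * H * b * (s + v)
        + (2 * k * m * H * m + (b * k * (2 * (k * H * c) + suc H * p) + (b * (k * k) * H * (p + m) + b * k * suc H * (m * m)))))))
        ≡⟨ right k H b m p c D Z W s v Δ ⟩
      4 * H * (k * k) * (m * m) + 2 * k * H * (m * m) + b * k * (m * m) + b * (k * k) * H * m + common ∎)
    where
    open ≤-Reasoning
    -- The part that occurs on both sides of the weighted sum of the hypotheses; it is added rather
    -- than subtracted because the terms are natural numbers.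
    common : ℕ
    common = 2 * H * (k * k) * b * c + 2 * H * (k * k) * b * Z + H * b * (k * k) * W + 2 * H * b * k * m * s
      + 2 * k * m * H * b * v + b * (k * k) * H * p + b * k * suc H * p + H * b * (k * k) * (m * m) + 2 * k * b * H * (m * m)
    left : ∀ k H b m p c D Z W s v Δ → H * b * (Δ + 2 * (k * k) * D) +
      (2 * H * (k * k) * b * c + 2 * H * (k * k) * b * Z + H * b * (k * k) * W + 2 * H * b * k * m * s
      + 2 * k * m * H * b * v + b * (k * k) * H * p + b * k * suc H * p + H * b * (k * k) * (m * m) + 2 * k * b * H * (m * m)) ≡
      2 * H * (k * k) * (b * (c + D)) + (H * b * (k * k) * (2 * Z + W) + (H * b * (Δ + 2 * (k * m * s)) + (2 * k * m * H * b * m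
        + (2 * k * m * H * (b * v) + (b * k * (k * H * p) + (b * (k * k) * H * (m * m) + b * k * suc H * p))))))
    left = solve-∀
    right : ∀ k H b m p c D Z W s v Δ →
      2 * H * (k * k) * (b * Z + 2 * (m * m)) + (H * b * (k * k) * (m * m) + (H * b * (k * k * W + k * (m * m)) + (2 * k * m * H * b * (s + v)
        + (2 * k * m * H * m + (b * k * (2 * (k * H * c) + suc H * p) + (b * (k * k) * H * (p + m) + b * k * suc H * (m * m))))))) ≡
      4 * H * (k * k) * (m * m) + 2 * k * H * (m * m) + b * k * (m * m) + b * (k * k) * H * m +
      (2 * H * (k * k) * b * c + 2 * H * (k * k) * b * Z + H * b * (k * k) * W + 2 * H * b * k * m * s
      + 2 * k * m * H * b * v + b * (k * k) * H * p + b * k * suc H * p + H * b * (k * k) * (m * m) + 2 * k * b * H * (m * m))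
    right = solve-∀

  m*m≤n*n⇒m≤n : ∀ {x y} → x * x ≤ y * y → x ≤ y
  m*m≤n*n⇒m≤n {x} {y} le with x ≤? y
  ... | yes x≤y = x≤y
  ... | no  x≰y = contradiction le (<⇒≱ (*-mono-< (≰⇒> x≰y) (≰⇒> x≰y)))

  -- For these constants 4 T times the last right-hand side is at most 3 H b m².
  absorb : ∀ k T b m H X → 1 ≤ k → H ≡ 4 * k * T → 32 * (k * k) * T ≤ b → 4 * (k * k) * T ≤ m → 1 ≤ H * b →
    H * b * X ≤ 4 * H * (k * k) * (m * m) + 2 * k * H * (m * m) + b * k * (m * m) + b * (k * k) * H * m →
    T * X ≤ m * m
  absorb k T b m H X 1≤k refl b≥ m≥ Hb≥1 le = *-cancelˡ-≤ (4 * (H * b)) {{>-nonZero (*-mono-≤ (s≤s {n = 3} z≤n) Hb≥1)}} (begin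
    4 * (H * b) * (T * X)
      ≡⟨ e1 T H b X ⟩
    4 * T * (H * b * X)
      ≤⟨ *-monoʳ-≤ (4 * T) le ⟩
    4 * T * (4 * H * (k * k) * (m * m) + 2 * k * H * (m * m) + b * k * (m * m) + b * (k * k) * H * m)
      -- Each of the three groups is at most b H m²: the first by the bound on `b`, the second
      -- because H = 4 k T, the third by the bound on `m`.
      ≡⟨ e2 T H k b m ⟩
    (16 * (k * k) * T + 8 * (1 * k) * T) * (H * (m * m)) + b * (4 * k * T) * (m * m) + b * H * m * (4 * (k * k) * T)
      ≤⟨ +-mono-≤ (+-monoˡ-≤ (b * (4 * k * T) * (m * m)) (*-monoˡ-≤ (H * (m * m)) small)) (*-monoʳ-≤ (b * H * m) m≥) ⟩
    b * (H * (m * m)) + b * H * (m * m) + b * H * m * m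
      ≤⟨ m≤m+n _ (b * H * m * m) ⟩
    b * (H * (m * m)) + b * H * (m * m) + b * H * m * m + b * H * m * m
      ≡⟨ e3 b H m ⟩
    4 * (H * b) * (m * m) ∎)
    where
    open ≤-Reasoning
    e1 : ∀ T H b X → 4 * (H * b) * (T * X) ≡ 4 * T * (H * b * X)
    e1 = solve-∀
    e2 : ∀ T H k b m → 4 * T * (4 * H * (k * k) * (m * m) + 2 * k * H * (m * m) + b * k * (m * m) + b * (k * k) * H * m)
      ≡ (16 * (k * k) * T + 8 * (1 * k) * T) * (H * (m * m)) + b * (4 * k * T) * (m * m) + b * H * m * (4 * (k * k) * T)
    e2 = solve-∀
    e3 : ∀ b H m → b * (H * (m * m)) + b * H * (m * m) + b * H * m * m + b * H * m * m ≡ 4 * (H * b) * (m * m)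
    e3 = solve-∀
    e4 : ∀ k T → 16 * (k * k) * T + 8 * (k * k) * T + 8 * (k * k) * T ≡ 32 * (k * k) * T
    e4 = solve-∀
    small : 16 * (k * k) * T + 8 * (1 * k) * T ≤ b
    small = begin
      16 * (k * k) * T + 8 * (1 * k) * T   ≤⟨ +-monoʳ-≤ (16 * (k * k) * T) (*-monoˡ-≤ T (*-monoʳ-≤ 8 (*-monoˡ-≤ k 1≤k))) ⟩
      16 * (k * k) * T + 8 * (k * k) * T   ≤⟨ m≤m+n _ (8 * (k * k) * T) ⟩
      16 * (k * k) * T + 8 * (k * k) * T + 8 * (k * k) * T ≡⟨ e4 k T ⟩
      32 * (k * k) * T                     ≤⟨ b≥ ⟩
      b                                    ∎

  module Classes {n : ℕ} (F : List (Subset n)) (k : ℕ) (ρ : Subset n → ℕ) (ρ≤k : ∀ A → ρ A ≤ k) where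

    m : ℕ
    m = length F

    -- Rank `k` is left out: that class is small enough for all its pairs to be counted as errors.
    Violates : Subset n → Subset n → Set
    Violates A B = ρ B < ρ A × ρ A < k × ¬ (B ⊆ A)

    violates? : ∀ A B → Dec (Violates A B)
    violates? A B = (ρ B <? ρ A) ×-dec (ρ A <? k) ×-dec ¬? (B ⊆? A)

    violations : ℕ
    violations = ∑ F (λ A → ∑ F (λ B → 𝟙 (violates? A B)))

    class : ℕ → ℕ
    class i = ∑ F (λ A → 𝟙 (ρ A ≟ i))

    ordered? : ∀ A B → Dec (ρ B < ρ A × ρ A < k)
    ordered? A B = (ρ B <? ρ A) ×-dec (ρ A <? k)

    ∑∑1 : ∑ F (λ A → ∑ F (λ B → 1)) ≡ m * m
    ∑∑1 = trans (∑-cong F (λ A → trans (∑-const F 1) (*-identityʳ m))) (∑-const F m)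

    class-sum : m ≤ ∑ (allFin k) (λ i → class (toℕ i)) + class k
    class-sum = begin
      m                     ≡⟨ trans (∑-const F 1) (*-identityʳ m) ⟨
      ∑ F (λ A → 1)         ≤⟨ ∑-mono F (λ A _ → one A) ⟩
      ∑ F (λ A → ∑ (allFin k) (λ i → 𝟙 (ρ A ≟ toℕ i)) + 𝟙 (ρ A ≟ k))  ≡⟨ ∑-+ F _ _ ⟩
      ∑ F (λ A → ∑ (allFin k) (λ i → 𝟙 (ρ A ≟ toℕ i))) + class k
                            ≡⟨ cong (_+ class k) (∑-swap F (allFin k) _) ⟩
      ∑ (allFin k) (λ i → class (toℕ i)) + class k ∎
      where
      open ≤-Reasoning
      one : ∀ A → 1 ≤ ∑ (allFin k) (λ i → 𝟙 (ρ A ≟ toℕ i)) + 𝟙 (ρ A ≟ k)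
      one A = begin
        1                                                              ≡⟨ 𝟙-yes (yes (ρ≤k A)) (ρ≤k A) ⟨
        𝟙 (yes (ρ≤k A))                                                ≤⟨ 𝟙-cover (yes (ρ≤k A)) (ρ A <? k) (ρ A ≟ k) m≤n⇒m<n∨m≡n ⟩
        𝟙 (ρ A <? k) + 𝟙 (ρ A ≟ k)                                     ≡⟨ cong (_+ 𝟙 (ρ A ≟ k)) (∑-𝟙≟ k (ρ A)) ⟨
        ∑ (allFin k) (λ i → 𝟙 (ρ A ≟ toℕ i)) + 𝟙 (ρ A ≟ k)             ∎

    ordered-pairs : ℕ
    ordered-pairs = ∑ F (λ A → ∑ F (λ B → 𝟙 (ordered? A B)))

    ∑-class² : ∑ (allFin k) (λ i → class (toℕ i) * class (toℕ i)) ≡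
               ∑ F (λ A → ∑ F (λ B → ∑ (allFin k) (λ i → 𝟙 (ρ A ≟ toℕ i) * 𝟙 (ρ B ≟ toℕ i))))
    ∑-class² = begin-equality
      ∑ (allFin k) (λ i → class (toℕ i) * class (toℕ i))
        ≡⟨ ∑-cong (allFin k) (λ i → sym (∑-∑-* F F (λ A → 𝟙 (ρ A ≟ toℕ i)) (λ B → 𝟙 (ρ B ≟ toℕ i)))) ⟩
      ∑ (allFin k) (λ i → ∑ F (λ A → ∑ F (λ B → 𝟙 (ρ A ≟ toℕ i) * 𝟙 (ρ B ≟ toℕ i))))
        ≡⟨ ∑-swap (allFin k) F _ ⟩
      ∑ F (λ A → ∑ (allFin k) (λ i → ∑ F (λ B → 𝟙 (ρ A ≟ toℕ i) * 𝟙 (ρ B ≟ toℕ i))))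
        ≡⟨ ∑-cong F (λ A → ∑-swap (allFin k) F _) ⟩
      ∑ F (λ A → ∑ F (λ B → ∑ (allFin k) (λ i → 𝟙 (ρ A ≟ toℕ i) * 𝟙 (ρ B ≟ toℕ i)))) ∎
      where open ≤-Reasoning

    -- For each ordered pair of members, at most one of three things holds: increasing rank,
    -- decreasing rank, or a common rank below `k`.
    ordered+class² : 2 * ordered-pairs + ∑ (allFin k) (λ i → class (toℕ i) * class (toℕ i)) ≤ m * m
    ordered+class² = begin
      2 * ordered-pairs + W
        ≡⟨ cong₂ _+_ (trans (cong (ordered-pairs +_) (+-identityʳ ordered-pairs)) (cong (ordered-pairs +_) (∑-swap F F _))) ∑-class² ⟩
      (∑ F (λ A → ∑ F (λ B → 𝟙 (ordered? A B))) + ∑ F (λ A → ∑ F (λ B → 𝟙 (ordered? B A)))) + ∑ F (λ A → ∑ F (λ B → same A B))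
        ≡⟨ cong (_+ ∑ F (λ A → ∑ F (λ B → same A B))) (sym (∑∑-+ _ _)) ⟩
      ∑ F (λ A → ∑ F (λ B → 𝟙 (ordered? A B) + 𝟙 (ordered? B A))) + ∑ F (λ A → ∑ F (λ B → same A B))
        ≡⟨ sym (∑∑-+ _ _) ⟩
      ∑ F (λ A → ∑ F (λ B → 𝟙 (ordered? A B) + 𝟙 (ordered? B A) + same A B))
        ≤⟨ ∑-mono F (λ A _ → ∑-mono F (λ B _ → pair A B)) ⟩
      ∑ F (λ A → ∑ F (λ B → 1))
        ≡⟨ ∑∑1 ⟩
      m * m ∎
      where
      open ≤-Reasoning
      W : ℕ
      W = ∑ (allFin k) (λ i → class (toℕ i) * class (toℕ i))
      same : Subset n → Subset n → ℕ
      same A B = ∑ (allFin k) (λ i → 𝟙 (ρ A ≟ toℕ i) * 𝟙 (ρ B ≟ toℕ i))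
      ∑∑-+ : ∀ (f g : Subset n → Subset n → ℕ) →
        ∑ F (λ A → ∑ F (λ B → f A B + g A B)) ≡ ∑ F (λ A → ∑ F (f A)) + ∑ F (λ A → ∑ F (g A))
      ∑∑-+ f g = trans (∑-cong F (λ A → ∑-+ F (f A) (g A))) (∑-+ F _ _)
      same≤ : ∀ A B → same A B ≤ 𝟙 (ρ A ≟ ρ B)
      same≤ A B = begin
        same A B
          ≤⟨ ∑-mono (allFin k) (λ i _ → term i) ⟩
        ∑ (allFin k) (λ i → 𝟙 (ρ A ≟ toℕ i) * 𝟙 (ρ A ≟ ρ B))
          ≡⟨ ∑-*ʳ (allFin k) (𝟙 (ρ A ≟ ρ B)) _ ⟩
        ∑ (allFin k) (λ i → 𝟙 (ρ A ≟ toℕ i)) * 𝟙 (ρ A ≟ ρ B)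
          ≤⟨ *-monoˡ-≤ (𝟙 (ρ A ≟ ρ B)) (≤-trans (≤-reflexive (∑-𝟙≟ k (ρ A))) (𝟙≤1 (ρ A <? k))) ⟩
        1 * 𝟙 (ρ A ≟ ρ B)
          ≡⟨ *-identityˡ _ ⟩
        𝟙 (ρ A ≟ ρ B) ∎
        where
        term : ∀ i → 𝟙 (ρ A ≟ toℕ i) * 𝟙 (ρ B ≟ toℕ i) ≤ 𝟙 (ρ A ≟ toℕ i) * 𝟙 (ρ A ≟ ρ B)
        term i with ρ A ≟ toℕ i
        ... | no  _ = z≤n
        ... | yes eq = *-monoʳ-≤ 1 (𝟙-mono (ρ B ≟ toℕ i) (ρ A ≟ ρ B) (λ eq′ → trans eq (sym eq′)))
      pair : ∀ A B → 𝟙 (ordered? A B) + 𝟙 (ordered? B A) + same A B ≤ 1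
      pair A B = begin
        𝟙 (ordered? A B) + 𝟙 (ordered? B A) + same A B
          ≤⟨ +-mono-≤ (𝟙-disjoint (ordered? A B) (ordered? B A) ((ρ B <? ρ A) ⊎-dec (ρ A <? ρ B))
               (λ p q → <-asym (proj₁ p) (proj₁ q)) (λ p → inj₁ (proj₁ p)) (λ p → inj₂ (proj₁ p))) (same≤ A B) ⟩
        𝟙 ((ρ B <? ρ A) ⊎-dec (ρ A <? ρ B)) + 𝟙 (ρ A ≟ ρ B)
          ≤⟨ 𝟙-disjoint ((ρ B <? ρ A) ⊎-dec (ρ A <? ρ B)) (ρ A ≟ ρ B) (yes refl)
               (λ { (inj₁ lt) eq → <⇒≢ lt (sym eq) ; (inj₂ lt) eq → <⇒≢ lt eq }) (λ _ → refl {x = 0}) (λ _ → refl) ⟩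
        1 ∎

    comparabilities : ℕ
    comparabilities = ∑ F (λ A → ∑ F (λ B → 𝟙 (B ⊆? A)))

    -- A violation is never an inclusion B ⊆ A, so in the row of `A` the two counts together exceed
    -- the number of sets of lower rank only by inclusions from equal or higher rank, at most m / b.
    -- Rows of rank `k` cost up to m each but number at most m / b. Hence the error 2 m² / b.
    comparable+violations : ∀ b →
      (∀ A → ρ A < k → b * ∑ F (λ B → 𝟙 ((ρ A ≤? ρ B) ×-dec (B ⊆? A))) ≤ m) →
      b * class k ≤ m →
      b * (comparabilities + violations) ≤ b * ordered-pairs + 2 * (m * m)
    comparable+violations b few-below few-top = begin
      b * (comparabilities + violations)
        ≡⟨ cong (b *_) (sym (∑-+ F _ _)) ⟩
      b * ∑ F (λ A → ∑ F (λ B → 𝟙 (B ⊆? A)) + ∑ F (λ B → 𝟙 (violates? A B)))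
        ≡⟨ ∑-*ˡ F b _ ⟨
      ∑ F (λ A → b * (∑ F (λ B → 𝟙 (B ⊆? A)) + ∑ F (λ B → 𝟙 (violates? A B))))
        ≤⟨ ∑-mono F (λ A _ → row A) ⟩
      ∑ F (λ A → b * ∑ F (λ B → 𝟙 (ordered? A B)) + (m + b * m * 𝟙 (ρ A ≟ k)))
        ≡⟨ ∑-+ F _ _ ⟩
      ∑ F (λ A → b * ∑ F (λ B → 𝟙 (ordered? A B))) + ∑ F (λ A → m + b * m * 𝟙 (ρ A ≟ k))
        ≡⟨ cong₂ _+_ (∑-*ˡ F b _) (trans (∑-+ F _ _) (cong₂ _+_ (∑-const F m) (∑-*ˡ F (b * m) _))) ⟩
      b * ordered-pairs + (m * m + b * m * class k)
        ≡⟨ cong (λ z → b * ordered-pairs + (m * m + z)) (regroup b m (class k)) ⟩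
      b * ordered-pairs + (m * m + m * (b * class k))
        ≤⟨ +-monoʳ-≤ (b * ordered-pairs) (+-monoʳ-≤ (m * m) (*-monoʳ-≤ m few-top)) ⟩
      b * ordered-pairs + (m * m + m * m)
        ≡⟨ cong (λ z → b * ordered-pairs + (m * m + z)) (+-identityʳ (m * m)) ⟨
      b * ordered-pairs + 2 * (m * m) ∎
      where
      open ≤-Reasoning
      regroup : ∀ x y z → x * y * z ≡ y * (x * z)
      regroup = solve-∀
      row : ∀ A → b * (∑ F (λ B → 𝟙 (B ⊆? A)) + ∑ F (λ B → 𝟙 (violates? A B))) ≤
                  b * ∑ F (λ B → 𝟙 (ordered? A B)) + (m + b * m * 𝟙 (ρ A ≟ k))
      row A with m≤n⇒m<n∨m≡n (ρ≤k A)
      ... | inj₂ ρ≡k = begin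
        b * (∑ F (λ B → 𝟙 (B ⊆? A)) + ∑ F (λ B → 𝟙 (violates? A B)))
          ≡⟨ cong (b *_) (∑-+ F _ _) ⟨
        b * ∑ F (λ B → 𝟙 (B ⊆? A) + 𝟙 (violates? A B))
          ≤⟨ *-monoʳ-≤ b (∑-mono F (λ B _ → 𝟙-disjoint (B ⊆? A) (violates? A B) (yes refl) (λ p q → proj₂ (proj₂ q) p) (λ _ → refl {x = 0}) (λ _ → refl))) ⟩
        b * ∑ F (λ B → 1)
          ≡⟨ cong (b *_) (trans (∑-const F 1) (*-identityʳ m)) ⟩
        b * m
          ≡⟨ trans (cong (b * m *_) (𝟙-yes (ρ A ≟ k) ρ≡k)) (*-identityʳ (b * m)) ⟨
        b * m * 𝟙 (ρ A ≟ k)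
          ≤⟨ ≤-trans (m≤n+m _ m) (m≤n+m _ (b * ∑ F (λ B → 𝟙 (ordered? A B)))) ⟩
        b * ∑ F (λ B → 𝟙 (ordered? A B)) + (m + b * m * 𝟙 (ρ A ≟ k)) ∎
      ... | inj₁ ρ<k = begin
        b * (∑ F (λ B → 𝟙 (B ⊆? A)) + ∑ F (λ B → 𝟙 (violates? A B)))
          ≡⟨ cong (b *_) (∑-+ F _ _) ⟨
        b * ∑ F (λ B → 𝟙 (B ⊆? A) + 𝟙 (violates? A B))
          ≤⟨ *-monoʳ-≤ b (∑-mono F (λ B _ → pair B)) ⟩
        b * ∑ F (λ B → 𝟙 (ordered? A B) + 𝟙 (up? B))
          ≡⟨ cong (b *_) (∑-+ F _ _) ⟩
        b * (∑ F (λ B → 𝟙 (ordered? A B)) + ∑ F (λ B → 𝟙 (up? B)))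
          ≡⟨ *-distribˡ-+ b _ _ ⟩
        b * ∑ F (λ B → 𝟙 (ordered? A B)) + b * ∑ F (λ B → 𝟙 (up? B))
          ≤⟨ +-monoʳ-≤ (b * ∑ F (λ B → 𝟙 (ordered? A B))) (≤-trans (few-below A ρ<k) (m≤m+n m _)) ⟩
        b * ∑ F (λ B → 𝟙 (ordered? A B)) + (m + b * m * 𝟙 (ρ A ≟ k)) ∎
        where
        up? : ∀ B → Dec (ρ A ≤ ρ B × B ⊆ A)
        up? B = (ρ A ≤? ρ B) ×-dec (B ⊆? A)
        pair : ∀ B → 𝟙 (B ⊆? A) + 𝟙 (violates? A B) ≤ 𝟙 (ordered? A B) + 𝟙 (up? B)
        pair B with ρ B <? ρ A
        ... | yes lt rewrite 𝟙-yes (yes lt ×-dec (ρ A <? k)) (lt , ρ<k) =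
          ≤-trans (𝟙-disjoint (B ⊆? A) (yes lt ×-dec (ρ A <? k) ×-dec ¬? (B ⊆? A)) (yes refl)
            (λ p q → proj₂ (proj₂ q) p) (λ _ → refl {x = 0}) (λ _ → refl)) (m≤m+n 1 _)
        ... | no ≮ = ≤-trans (≤-reflexive (+-identityʳ _))
                       (𝟙-mono (B ⊆? A) (up? B) (λ p → ≮⇒≥ ≮ , p))

    -- The squares (k |class i| - m)² expanded and summed. The left sum is k² times the squared
    -- deviation of the class sizes from m / k, and it measures the loss against the Turán bound.
    deviation-sum : ∑ (allFin k) (λ i → ∣ k * class (toℕ i) - m ∣ * ∣ k * class (toℕ i) - m ∣)
        + 2 * (k * m * ∑ (allFin k) (λ i → class (toℕ i)))
      ≡ k * k * ∑ (allFin k) (λ i → class (toℕ i) * class (toℕ i)) + k * (m * m)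
    deviation-sum = begin-equality
      ∑ I (λ i → dist i * dist i) + 2 * (k * m * ∑ I v)
        ≡⟨ cong (∑ I (λ i → dist i * dist i) +_) (trans (sym (*-assoc 2 (k * m) _)) (sym (∑-*ˡ I (2 * (k * m)) v))) ⟩
      ∑ I (λ i → dist i * dist i) + ∑ I (λ i → 2 * (k * m) * v i)
        ≡⟨ ∑-+ I _ _ ⟨
      ∑ I (λ i → dist i * dist i + 2 * (k * m) * v i)
        ≡⟨ ∑-cong I (λ i → trans (cong (dist i * dist i +_) (e1 k m (v i))) (trans (∣-∣-square (k * v i) m) (e2 k m (v i)))) ⟩
      ∑ I (λ i → k * k * (v i * v i) + m * m)
        ≡⟨ ∑-+ I _ _ ⟩
      ∑ I (λ i → k * k * (v i * v i)) + ∑ I (λ i → m * m)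
        ≡⟨ cong₂ _+_ (∑-*ˡ I (k * k) _) (trans (∑-const I (m * m)) (cong (_* (m * m)) (length-tabulate {n = k} (λ i → i)))) ⟩
      k * k * ∑ I (λ i → v i * v i) + k * (m * m) ∎
      where
      open ≤-Reasoning
      I : List (Fin k)
      I = allFin k
      v dist : Fin k → ℕ
      v i = class (toℕ i)
      dist i = ∣ k * v i - m ∣
      e1 : ∀ k m v → 2 * (k * m) * v ≡ 2 * (k * v * m)
      e1 = solve-∀
      e2 : ∀ k m v → k * v * (k * v) + m * m ≡ k * k * (v * v) + m * m
      e2 = solve-∀

    module _ (b H S p : ℕ) (1≤k : 1 ≤ k) (1≤S : 1 ≤ S)
      (few-below : ∀ A → ρ A < k → b * ∑ F (λ B → 𝟙 ((ρ A ≤? ρ B) ×-dec (B ⊆? A))) ≤ m)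
      (few-top : b * class k ≤ m)
      (H≡ : H ≡ 4 * k * (S * S)) (b≥ : 32 * (k * k) * (S * S) ≤ b) (m≥ : 4 * (k * k) * (S * S) ≤ m)
      (p+m≡ : p + m ≡ m * m)
      (dense : k * H * p ≤ 2 * (k * H * comparablePairs F) + suc H * p) where

      open ≤-Reasoning

      private
        dist : Fin k → ℕ
        dist i = ∣ k * class (toℕ i) - m ∣

      -- Twice the number of inclusions is at most m² - Σ |class i|² - 2 violations up to O(m² / b),
      -- and k² Σ |class i|² exceeds k m² by the squared deviation, up to the top class. Density
      -- leaves room only for 4k² m²/b + 2k m²/b from the exceptional pairs and the top class, k
      -- m²/H from η, and k² m from the diagonal. So deviation and violations are both small.
      structure : S * S * (∑ (allFin k) (λ i → dist i * dist i) + 2 * (k * k) * violations) ≤ m * m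
      structure = absorb k (S * S) b m H _ 1≤k H≡ b≥ m≥ Hb≥1
        (combine k H b m p comparabilities violations ordered-pairs _ _ (class k) _
          (comparable+violations b few-below few-top) ordered+class² class-sum few-top deviation-sum
          (≤-trans dense (+-monoˡ-≤ (suc H * p) (*-monoʳ-≤ 2 (*-monoʳ-≤ (k * H) (comparablePairs≤ F))))) p+m≡)
        where
        Hb≥1 : 1 ≤ H * b
        Hb≥1 = subst (λ h → 1 ≤ h * b) (sym H≡)
          (*-mono-≤ (*-mono-≤ (*-mono-≤ (s≤s {n = 3} z≤n) 1≤k) (*-mono-≤ 1≤S 1≤S))
            (≤-trans (*-mono-≤ (*-mono-≤ (s≤s {n = 31} z≤n) (*-mono-≤ 1≤k 1≤k)) (*-mono-≤ 1≤S 1≤S)) b≥))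

      few-violations : S * S * (2 * violations) ≤ m * m
      few-violations = begin
        S * S * (2 * violations)
          ≤⟨ *-monoʳ-≤ (S * S) (*-monoˡ-≤ violations (*-monoʳ-≤ 2 (*-mono-≤ 1≤k 1≤k))) ⟩
        S * S * (2 * (k * k) * violations)
          ≤⟨ *-monoʳ-≤ (S * S) (m≤n+m _ (∑ (allFin k) (λ i → dist i * dist i))) ⟩
        S * S * (∑ (allFin k) (λ i → dist i * dist i) + 2 * (k * k) * violations)
          ≤⟨ structure ⟩
        m * m ∎

      -- A single summand of the squared deviation is already at most (m / S)².
      class-large : ∀ i → S * m ≤ S * (k * class (toℕ i)) + m
      class-large i = begin
        S * m                                    ≤⟨ *-monoʳ-≤ S (m≤n+∣n-m∣ m (k * class (toℕ i))) ⟩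
        S * (k * class (toℕ i) + dist i)         ≡⟨ *-distribˡ-+ S _ _ ⟩
        S * (k * class (toℕ i)) + S * dist i     ≤⟨ +-monoʳ-≤ (S * (k * class (toℕ i))) (m*m≤n*n⇒m≤n square) ⟩
        S * (k * class (toℕ i)) + m              ∎
        where
        square : S * dist i * (S * dist i) ≤ m * m
        square = begin
          S * dist i * (S * dist i)              ≡⟨ *-interchange S (dist i) S (dist i) ⟩
          S * S * (dist i * dist i)              ≤⟨ *-monoʳ-≤ (S * S) (≤-trans (f≤∑ (allFin k) (λ i → dist i * dist i) (∈-allFin i)) (m≤m+n _ _)) ⟩
          S * S * (∑ (allFin k) (λ i → dist i * dist i) + 2 * (k * k) * violations) ≤⟨ structure ⟩
          m * m                                  ∎

  -- Typical sets and the bits they share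

  least : {P : ℕ → Set} (P? : ∀ i → Dec (P i)) (k : ℕ) →
    (∀ i → i < k → ¬ P i) ⊎ (∃ λ i → P i × (∀ j → j < i → ¬ P j))
  least P? zero = inj₁ (λ i ())
  least P? (suc k) with least P? k
  ... | inj₂ found = inj₂ found
  ... | inj₁ none with P? k
  ...   | yes p = inj₂ (k , p , none)
  ...   | no ¬p = inj₁ λ i i<1+k → [ (λ i<k → none i i<k) , (λ { refl → ¬p }) ] (m≤n⇒m<n∨m≡n (s≤s⁻¹ i<1+k))

  -- Bernoulli's inequality (1 + 1/z)^M ≥ 1 + M/z with denominators cleared.
  bernoulli : ∀ z M → z ^ M * (z + M) ≤ z * suc z ^ M
  bernoulli z zero    = ≤-reflexive (trans (*-identityˡ (z + 0)) (trans (+-identityʳ z) (sym (*-identityʳ z))))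
  bernoulli z (suc M) = begin
    z * z ^ M * (z + suc M)                    ≡⟨ e1 z (z ^ M) M ⟩
    z * (z ^ M * (z + M)) + z ^ M * z          ≤⟨ +-monoʳ-≤ (z * (z ^ M * (z + M))) (*-monoʳ-≤ (z ^ M) (m≤m+n z M)) ⟩
    z * (z ^ M * (z + M)) + z ^ M * (z + M)    ≡⟨ e2 z (z ^ M * (z + M)) ⟩
    suc z * (z ^ M * (z + M))                  ≤⟨ *-monoʳ-≤ (suc z) (bernoulli z M) ⟩
    suc z * (z * suc z ^ M)                    ≡⟨ e3 z (suc z ^ M) ⟩
    z * (suc z * suc z ^ M)                    ∎
    where
    open ≤-Reasoning
    e1 : ∀ z y M → z * y * (z + suc M) ≡ z * (y * (z + M)) + y * z
    e1 = solve-∀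
    e2 : ∀ z x → z * x + x ≡ suc z * x
    e2 = solve-∀
    e3 : ∀ z x → suc z * (z * x) ≡ z * (suc z * x)
    e3 = solve-∀

  -- With exponent z², Bernoulli's inequality yields exactly one extra factor z + 1.
  growth : ∀ z → 1 ≤ z → z ^ (z * z) * suc z ≤ suc z ^ (z * z)
  growth z 1≤z = *-cancelˡ-≤ z {{>-nonZero 1≤z}} (begin
    z * (z ^ (z * z) * suc z)        ≡⟨ e1 z (z ^ (z * z)) ⟩
    z ^ (z * z) * (z + z * z)        ≤⟨ bernoulli z (z * z) ⟩
    z * suc z ^ (z * z)              ∎)
    where
    open ≤-Reasoning
    e1 : ∀ z y → z * (y * suc z) ≡ y * (z + z * z)
    e1 = solve-∀

  -- A deviation loses one factor z + 1. By `growth`, replacing z by z + 1 in z² factors gains that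
  -- much, and there are at least z² factors for every deviation.
  power-few-deviations : ∀ z E v → 1 ≤ z → z * z * v ≤ E + v → z ^ (E + v) ≤ suc z ^ E
  power-few-deviations z E v 1≤z few = *-cancelʳ-≤ _ _ (suc z ^ v) {{m^n≢0 (suc z) v}} (begin
    z ^ (E + v) * suc z ^ v                      ≡⟨ cong (λ y → z ^ y * suc z ^ v) q≡ ⟩
    z ^ (z * z * v + r) * suc z ^ v              ≡⟨ cong (_* suc z ^ v) (trans (^-distribˡ-+-* z (z * z * v) r) (cong (_* z ^ r) (sym (^-*-assoc z (z * z) v)))) ⟩
    (z ^ (z * z)) ^ v * z ^ r * suc z ^ v        ≡⟨ e1 ((z ^ (z * z)) ^ v) (z ^ r) (suc z ^ v) ⟩
    (z ^ (z * z)) ^ v * suc z ^ v * z ^ r        ≡⟨ cong (_* z ^ r) (sym (^-distribʳ-* (z ^ (z * z)) (suc z) v)) ⟩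
    (z ^ (z * z) * suc z) ^ v * z ^ r            ≤⟨ *-mono-≤ (^-monoˡ-≤ v (growth z 1≤z)) (^-monoˡ-≤ r (n≤1+n z)) ⟩
    (suc z ^ (z * z)) ^ v * suc z ^ r            ≡⟨ trans (^-distribˡ-+-* (suc z) (z * z * v) r) (cong (_* suc z ^ r) (sym (^-*-assoc (suc z) (z * z) v))) ⟨
    suc z ^ (z * z * v + r)                      ≡⟨ cong (suc z ^_) q≡ ⟨
    suc z ^ (E + v)                              ≡⟨ ^-distribˡ-+-* (suc z) E v ⟩
    suc z ^ E * suc z ^ v                        ∎)
    where
    open ≤-Reasoning
    r : ℕ
    r = E + v ∸ z * z * v
    q≡ : E + v ≡ z * z * v + r
    q≡ = sym (m+[n∸m]≡n few)
    e1 : ∀ a b c → a * b * c ≡ a * c * b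
    e1 = solve-∀

  module TypicalSets {n : ℕ} (F : List (Subset n)) (k : ℕ) (ρ : Subset n → ℕ) (ρ≤k : ∀ A → ρ A ≤ k) (a : ℕ) where
    open Classes F k ρ ρ≤k

    defect : Subset n → ℕ
    defect A = ∑ F (λ B → 𝟙 (violates? A B) + 𝟙 (violates? B A))

    Typical : Subset n → Set
    Typical A = ρ A < k × a * defect A ≤ m

    typical? : ∀ A → Dec (Typical A)
    typical? A = (ρ A <? k) ×-dec (a * defect A ≤? m)

    bad : List (Subset n)
    bad = filter (λ A → ¬? (typical? A)) F

    -- Markov's inequality: a bad set has rank `k` or satisfies a · defect > m. The defects sum to
    -- twice the violations, since each violation is seen from both of its sets.
    bad-count : m * length bad ≤ m * class k + a * (2 * violations)
    bad-count = begin
      m * length bad                                        ≡⟨ cong (m *_) (length-filter _ F) ⟩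
      m * ∑ F (λ A → 𝟙 (¬? (typical? A)))                   ≡⟨ ∑-*ˡ F m _ ⟨
      ∑ F (λ A → m * 𝟙 (¬? (typical? A)))                   ≤⟨ ∑-mono F (λ A _ → term A) ⟩
      ∑ F (λ A → m * 𝟙 (ρ A ≟ k) + a * defect A)            ≡⟨ ∑-+ F _ _ ⟩
      ∑ F (λ A → m * 𝟙 (ρ A ≟ k)) + ∑ F (λ A → a * defect A) ≡⟨ cong₂ _+_ (∑-*ˡ F m _) (trans (∑-*ˡ F a defect) (cong (a *_) defect-sum)) ⟩
      m * class k + a * (2 * violations)                    ∎
      where
      open ≤-Reasoning
      defect-sum : ∑ F defect ≡ 2 * violations
      defect-sum = trans (∑-cong F (λ A → ∑-+ F _ _)) (trans (∑-+ F _ _)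
        (cong (violations +_) (trans (∑-swap F F (λ A B → 𝟙 (violates? B A))) (sym (+-identityʳ violations)))))
      term : ∀ A → m * 𝟙 (¬? (typical? A)) ≤ m * 𝟙 (ρ A ≟ k) + a * defect A
      term A with m≤n⇒m<n∨m≡n (ρ≤k A)
      ... | inj₂ ρ≡k = ≤-trans (*-monoʳ-≤ m (𝟙-mono (¬? (typical? A)) (ρ A ≟ k) (λ _ → ρ≡k))) (m≤m+n _ _)
      ... | inj₁ ρ<k with a * defect A ≤? m
      ...   | yes le = ≤-trans (≤-reflexive (trans (cong (m *_) (𝟙-no (¬? ((ρ A <? k) ×-dec yes le)) (λ ¬t → ¬t (ρ<k , le)))) (*-zeroʳ m))) z≤n
      ...   | no  ≰  = ≤-trans (*-monoʳ-≤ m (𝟙≤1 (¬? ((ρ A <? k) ×-dec no ≰))))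
                         (≤-trans (≤-reflexive (*-identityʳ m)) (≤-trans (<⇒≤ (≰⇒> ≰)) (m≤n+m _ (m * 𝟙 (ρ A ≟ k)))))

    -- The points by which the tower grows from its i-th to its (i+1)-st set. The condition concerns
    -- typical members only, but for these it is exact.
    Pure : ℕ → Fin n → Set
    Pure i x = ∀ A → A ∈ F → Typical A → (ρ A < i → ¬ x ∈ˢ A) × (i < ρ A → x ∈ˢ A)

    -- In contrast to `Pure`, this concerns all members of each class, up to m / a exceptions; no
    -- class is free at such a point.
    Weird : ℕ → Fin n → Set
    Weird s x = ∀ l → l < k →
      (l ≤ s → a * ∑ F (λ A → 𝟙 ((ρ A ≟ l) ×-dec (x ∈? A))) ≤ m) ×
      (s < l → a * ∑ F (λ A → 𝟙 ((ρ A ≟ l) ×-dec ¬? (x ∈? A))) ≤ m)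

    -- If x is not pure, take a typical A ∋ x of least rank i and a typical B ∌ x of rank above i.
    -- Members of rank ≤ i containing x violate B, members of rank > i missing x violate A.
    classify : 1 ≤ k → ∀ x → (Σ (Fin k) λ i → Pure (toℕ i) x) ⊎ (∃ λ s → Weird s x)
    classify 1≤k x with least (λ i → any? (λ A → typical? A ×-dec (ρ A ≟ i) ×-dec (x ∈? A)) F) k
    -- No typical set contains `x`. The last index k - 1 then works, as no typical rank exceeds it.
    ... | inj₁ none = inj₁ (fromℕ< k-1<k , λ A A∈ typ →
            (λ _ x∈A → none (ρ A) (proj₁ typ) (lose A∈ (typ , refl , x∈A))) ,
            (λ k-1<ρ → contradiction (proj₁ typ) (≤⇒≯ (pred-< (subst (_< ρ A) (toℕ-fromℕ< k-1<k) k-1<ρ)))))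
      where
      k-1<k : k ∸ 1 < k
      k-1<k = ≤-reflexive (m+[n∸m]≡n 1≤k)
      pred-< : ∀ {y} → k ∸ 1 < y → k ≤ y
      pred-< lt = ≤-trans (≤-reflexive (sym (m+[n∸m]≡n 1≤k))) lt
    ... | inj₂ (i , someA , below-i) with any? (λ B → typical? B ×-dec (i <? ρ B) ×-dec ¬? (x ∈? B)) F
    -- Typical sets of rank below `i` miss `x` by minimality of `i`; those of rank above `i` contain
    -- it because no `B` was found.
    ...   | no none = inj₁ (fromℕ< i<k , λ A A∈ typ →
              (λ ρ<i x∈A → below-i (ρ A) (subst (ρ A <_) (toℕ-fromℕ< i<k) ρ<i) (lose A∈ (typ , refl , x∈A))) ,
              (λ i<ρ → decidable-stable (x ∈? A) (λ x∉A → none (lose A∈ (typ , subst (_< ρ A) (toℕ-fromℕ< i<k) i<ρ , x∉A)))))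
      where
      i<k : i < k
      i<k = let A , _ , (ρ<k , _) , ρ≡ , _ = find someA in subst (_< k) ρ≡ ρ<k
    ...   | yes someB = inj₂ (i , λ l l<k → low l , high l l<k)
      where
      low : ∀ l → l ≤ i → a * ∑ F (λ A → 𝟙 ((ρ A ≟ l) ×-dec (x ∈? A))) ≤ m
      low l l≤i = let B , _ , (ρB<k , small) , i<ρB , x∉B = find someB in
        ≤-trans (*-monoʳ-≤ a (∑-mono F (λ A _ → ≤-trans
          (𝟙-mono ((ρ A ≟ l) ×-dec (x ∈? A)) (violates? B A)
            (λ { (ρA≡l , x∈A) → ≤-<-trans (≤-trans (≤-reflexive ρA≡l) l≤i) i<ρB , ρB<k , (λ A⊆B → x∉B (A⊆B x∈A)) }))
          (m≤m+n _ _)))) small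
      high : ∀ l → l < k → i < l → a * ∑ F (λ A → 𝟙 ((ρ A ≟ l) ×-dec ¬? (x ∈? A))) ≤ m
      high l l<k i<l = let A , _ , (_ , small) , ρA≡i , x∈A = find someA in
        ≤-trans (*-monoʳ-≤ a (∑-mono F (λ B _ → ≤-trans
          (𝟙-mono ((ρ B ≟ l) ×-dec ¬? (x ∈? B)) (violates? B A)
            (λ { (refl , x∉B) → ≤-<-trans (≤-reflexive ρA≡i) i<l , l<k , (λ A⊆B → x∉B (A⊆B x∈A)) }))
          (m≤n+m _ _)))) small

    Kind : Fin n → Set
    Kind x = (Σ (Fin k) λ i → Pure (toℕ i) x) ⊎ (∃ λ s → Weird s x)

    pureAt : ∀ {x} → ℕ → Kind x → ℕ
    pureAt l (inj₁ (i , _)) = 𝟙 (toℕ i ≟ l)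
    pureAt l (inj₂ _)       = 0

    weirdAt : ∀ {x} → Kind x → ℕ
    weirdAt (inj₁ _) = 0
    weirdAt (inj₂ _) = 1

    pureIndex : ∀ {x} (κ : Kind x) → weirdAt κ ≡ 0 → Σ (Fin k) λ i → Pure (toℕ i) x × (∀ l → pureAt l κ ≡ 𝟙 (toℕ i ≟ l))
    pureIndex (inj₁ (i , pure)) _ = i , pure , λ _ → refl
    pureIndex (inj₂ _)          ()

    -- At a weird point with threshold `s` the expected bit of class `l` is "present" exactly when s
    -- < l. Pure points never count as deviating.
    deviates : ∀ {x} → ℕ → Kind x → Bool → ℕ
    deviates l (inj₁ _)       b = 0
    deviates l (inj₂ (s , _)) b with s <? l | b
    ... | yes _ | true  = 0
    ... | yes _ | false = 1
    ... | no  _ | true  = 1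
    ... | no  _ | false = 0

    deviates≤weirdAt : ∀ {x} l (κ : Kind x) b → deviates l κ b ≤ weirdAt κ
    deviates≤weirdAt l (inj₁ _) b = z≤n
    deviates≤weirdAt l (inj₂ (s , _)) b with s <? l | b
    ... | yes _ | true  = z≤n
    ... | yes _ | false = ≤-refl
    ... | no  _ | true  = ≤-refl
    ... | no  _ | false = z≤n

    deviates-above : ∀ {x s l} {w : Weird s x} → s < l → ∀ A → deviates l (inj₂ (s , w)) (lookup A x) ≤ 𝟙 (¬? (x ∈? A))
    deviates-above {x} {s} {l} s<l A with s <? l | x ∈? A
    ... | no s≮l | _       = contradiction s<l s≮l
    ... | yes _  | yes x∈A rewrite lookup≡true x∈A  = z≤n
    ... | yes _  | no  x∉A rewrite lookup≡false x∉A = ≤-refl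

    deviates-below : ∀ {x s l} {w : Weird s x} → ¬ s < l → ∀ A → deviates l (inj₂ (s , w)) (lookup A x) ≤ 𝟙 (x ∈? A)
    deviates-below {x} {s} {l} s≮l A with s <? l | x ∈? A
    ... | yes s<l | _       = contradiction s<l s≮l
    ... | no _    | yes x∈A rewrite lookup≡true x∈A  = ≤-refl
    ... | no _    | no  x∉A rewrite lookup≡false x∉A = z≤n

    module WithKinds (kind : ∀ x → Kind x) where

      pures : ℕ → ℕ
      pures l = ∑ (allFin n) (λ x → pureAt l (kind x))

      weirds : ℕ
      weirds = ∑ (allFin n) (λ x → weirdAt (kind x))

      deviation : ℕ → Subset n → ℕ
      deviation l A = ∑ (allFin n) (λ x → deviates l (kind x) (lookup A x))

      -- A point may qualify for several kinds; the fixed choice `kind` assigns each point to a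
      -- single class index below `k` or to the weird points.
      pures+weirds : ∑ (allFin k) (λ i → pures (toℕ i)) + weirds ≡ n
      pures+weirds = begin-equality
        ∑ (allFin k) (λ i → pures (toℕ i)) + weirds
          ≡⟨ cong (_+ weirds) (∑-swap (allFin k) (allFin n) _) ⟩
        ∑ (allFin n) (λ x → ∑ (allFin k) (λ i → pureAt (toℕ i) (kind x))) + weirds
          ≡⟨ ∑-+ (allFin n) _ _ ⟨
        ∑ (allFin n) (λ x → ∑ (allFin k) (λ i → pureAt (toℕ i) (kind x)) + weirdAt (kind x))
          ≡⟨ ∑-cong (allFin n) (λ x → one (kind x)) ⟩
        ∑ (allFin n) (λ x → 1)
          ≡⟨ trans (∑-const (allFin n) 1) (trans (*-identityʳ _) (length-tabulate {n = n} (λ x → x))) ⟩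
        n ∎
        where
        open ≤-Reasoning
        one : ∀ {x} (κ : Kind x) → ∑ (allFin k) (λ i → pureAt (toℕ i) κ) + weirdAt κ ≡ 1
        one (inj₁ (i , _)) = trans (+-identityʳ _) (trans (∑-𝟙≟ k (toℕ i)) (𝟙-yes (toℕ i <? k) (toℕ<n i)))
        one (inj₂ _)       = cong (_+ 1) (∑-zero (allFin k))

      not-weird : weirds ≡ 0 → ∀ x → weirdAt (kind x) ≡ 0
      not-weird weirds≡0 x = n≤0⇒n≡0 (≤-trans (f≤∑ (allFin n) (λ x → weirdAt (kind x)) (∈-allFin x)) (≤-reflexive weirds≡0))

      indexOf : weirds ≡ 0 → Fin n → Fin k
      indexOf weirds≡0 x = proj₁ (pureIndex (kind x) (not-weird weirds≡0 x))

      indexOf-pure : ∀ weirds≡0 x → Pure (toℕ (indexOf weirds≡0 x)) x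
      indexOf-pure weirds≡0 x = proj₁ (proj₂ (pureIndex (kind x) (not-weird weirds≡0 x)))

      indexOf-size : ∀ weirds≡0 l → ∑ (allFin n) (λ x → 𝟙 (toℕ (indexOf weirds≡0 x) ≟ l)) ≡ pures l
      indexOf-size weirds≡0 l = ∑-cong (allFin n) (λ x → sym (proj₂ (proj₂ (pureIndex (kind x) (not-weird weirds≡0 x))) l))

      -- Double counting: each weird point is responsible for at most m / a deviating members of the
      -- class.
      deviation-total : ∀ l → l < k → a * ∑ F (λ A → 𝟙 (ρ A ≟ l) * deviation l A) ≤ weirds * m
      deviation-total l l<k = begin
        a * ∑ F (λ A → 𝟙 (ρ A ≟ l) * deviation l A)
          ≡⟨ cong (a *_) (trans (∑-cong F (λ A → sym (∑-*ˡ (allFin n) (𝟙 (ρ A ≟ l)) _))) (∑-swap F (allFin n) _)) ⟩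
        a * ∑ (allFin n) (λ x → ∑ F (λ A → 𝟙 (ρ A ≟ l) * deviates l (kind x) (lookup A x)))
          ≡⟨ ∑-*ˡ (allFin n) a _ ⟨
        ∑ (allFin n) (λ x → a * ∑ F (λ A → 𝟙 (ρ A ≟ l) * deviates l (kind x) (lookup A x)))
          ≤⟨ ∑-mono (allFin n) (λ x _ → column x (kind x)) ⟩
        ∑ (allFin n) (λ x → weirdAt (kind x) * m)
          ≡⟨ ∑-*ʳ (allFin n) m _ ⟩
        weirds * m ∎
        where
        open ≤-Reasoning
        column : ∀ x (κ : Kind x) → a * ∑ F (λ A → 𝟙 (ρ A ≟ l) * deviates l κ (lookup A x)) ≤ weirdAt κ * m
        column x (inj₁ _) = ≤-trans (≤-reflexive (trans (cong (a *_)
          (trans (∑-cong F (λ A → *-zeroʳ (𝟙 (ρ A ≟ l)))) (∑-zero F))) (*-zeroʳ a))) z≤n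
        column x κ@(inj₂ (s , weird)) = ≤-trans (bound (s <? l)) (≤-reflexive (sym (*-identityˡ m)))
          where
          summand : ∀ A {P : Set} (d : Dec P) → deviates l κ (lookup A x) ≤ 𝟙 d →
            𝟙 (ρ A ≟ l) * deviates l κ (lookup A x) ≤ 𝟙 ((ρ A ≟ l) ×-dec d)
          summand A d le = ≤-trans (*-monoʳ-≤ (𝟙 (ρ A ≟ l)) le)
            (≤-reflexive (sym (𝟙-* (ρ A ≟ l) d ((ρ A ≟ l) ×-dec d) _,_ (λ p → p))))
          bound : Dec (s < l) → a * ∑ F (λ A → 𝟙 (ρ A ≟ l) * deviates l κ (lookup A x)) ≤ m
          bound (yes s<l) = ≤-trans (*-monoʳ-≤ a (∑-mono F (λ A _ → summand A (¬? (x ∈? A)) (deviates-above {w = weird} s<l A))))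
                              (proj₂ (weird l l<k) s<l)
          bound (no s≮l)  = ≤-trans (*-monoʳ-≤ a (∑-mono F (λ A _ → summand A (x ∈? A) (deviates-below {w = weird} s≮l A))))
                              (proj₁ (weird l l<k) (≮⇒≥ s≮l))

      module _ (z : ℕ) (1≤z : 1 ≤ z) (l : ℕ) (l<k : l < k) where

        regular? : ∀ A → Dec (Typical A × ρ A ≡ l × z * z * deviation l A ≤ weirds)
        regular? A = typical? A ×-dec (ρ A ≟ l) ×-dec (z * z * deviation l A ≤? weirds)

        regular : List (Subset n)
        regular = filter regular? F

        -- A member of the class fails to be regular if it is not typical or deviates on more than a
        -- 1/z² fraction of the weird points; by Markov's inequality the latter happens for at most
        -- z² m / a members.
        regular-lower : a * class l ≤ a * length regular + a * length bad + z * z * m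
        regular-lower = begin
          a * class l
            ≤⟨ *-monoʳ-≤ a (∑-mono F (λ A _ → term A)) ⟩
          a * ∑ F (λ A → 𝟙 (regular? A) + 𝟙 (¬? (typical? A)) + 𝟙 (wild? A))
            ≡⟨ cong (a *_) (trans (∑-+ F _ _) (cong (_+ wild) (∑-+ F _ _))) ⟩
          a * (∑ F (λ A → 𝟙 (regular? A)) + ∑ F (λ A → 𝟙 (¬? (typical? A))) + wild)
            ≡⟨ cong₂ (λ x y → a * (x + y + wild)) (sym (length-filter regular? F)) (sym (length-filter _ F)) ⟩
          a * (length regular + length bad + wild)
            ≡⟨ e1 a (length regular) (length bad) wild ⟩
          a * length regular + a * length bad + a * wild
            ≤⟨ +-monoʳ-≤ (a * length regular + a * length bad) wild-rare ⟩
          a * length regular + a * length bad + z * z * m ∎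
          where
          open ≤-Reasoning
          e1 : ∀ a x y w → a * (x + y + w) ≡ a * x + a * y + a * w
          e1 = solve-∀
          wild? : ∀ A → Dec (ρ A ≡ l × ¬ (z * z * deviation l A ≤ weirds))
          wild? A = (ρ A ≟ l) ×-dec ¬? (z * z * deviation l A ≤? weirds)
          wild : ℕ
          wild = ∑ F (λ A → 𝟙 (wild? A))
          term : ∀ A → 𝟙 (ρ A ≟ l) ≤ 𝟙 (regular? A) + 𝟙 (¬? (typical? A)) + 𝟙 (wild? A)
          term A = ≤-trans (𝟙-cover (ρ A ≟ l) (regular? A ⊎-dec ¬? (typical? A)) (wild? A) split)
            (+-monoˡ-≤ (𝟙 (wild? A)) (𝟙-cover (regular? A ⊎-dec ¬? (typical? A)) (regular? A) (¬? (typical? A)) (λ p → p)))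
            where
            split : ρ A ≡ l → ((Typical A × ρ A ≡ l × z * z * deviation l A ≤ weirds) ⊎ ¬ Typical A)
                              ⊎ (ρ A ≡ l × ¬ (z * z * deviation l A ≤ weirds))
            split eq with typical? A | z * z * deviation l A ≤? weirds
            ... | no ¬t | _       = inj₁ (inj₂ ¬t)
            ... | yes _ | no  big = inj₂ (eq , big)
            ... | yes t | yes few = inj₁ (inj₁ (t , eq , few))
          wild-rare : a * wild ≤ z * z * m
          -- Wildness is a strict inequality, so z² · deviation ≥ `suc weirds`. Cancelling this
          -- positive number also covers the case without weird points.
          wild-rare = *-cancelˡ-≤ (suc weirds) (begin
            suc weirds * (a * wild)
              ≡⟨ e2 (suc weirds) a wild ⟩
            a * (suc weirds * wild)
              ≡⟨ cong (a *_) (∑-*ˡ F (suc weirds) _) ⟨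
            a * ∑ F (λ A → suc weirds * 𝟙 (wild? A))
              ≤⟨ *-monoʳ-≤ a (∑-mono F (λ A _ → markov A)) ⟩
            a * ∑ F (λ A → z * z * (𝟙 (ρ A ≟ l) * deviation l A))
              ≡⟨ cong (a *_) (∑-*ˡ F (z * z) _) ⟩
            a * (z * z * ∑ F (λ A → 𝟙 (ρ A ≟ l) * deviation l A))
              ≡⟨ e2 a (z * z) _ ⟩
            z * z * (a * ∑ F (λ A → 𝟙 (ρ A ≟ l) * deviation l A))
              ≤⟨ *-monoʳ-≤ (z * z) (≤-trans (deviation-total l l<k) (*-monoˡ-≤ m (n≤1+n weirds))) ⟩
            z * z * (suc weirds * m)
              ≡⟨ e2 (z * z) (suc weirds) m ⟩
            suc weirds * (z * z * m) ∎)
            where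
            e2 : ∀ x y w → x * (y * w) ≡ y * (x * w)
            e2 = solve-∀
            markov : ∀ A → suc weirds * 𝟙 (wild? A) ≤ z * z * (𝟙 (ρ A ≟ l) * deviation l A)
            markov A with ρ A ≟ l | z * z * deviation l A ≤? weirds
            ... | no  _ | _       = ≤-trans (≤-reflexive (*-zeroʳ weirds)) z≤n
            ... | yes _ | yes _   = ≤-trans (≤-reflexive (*-zeroʳ weirds)) z≤n
            ... | yes _ | no  big = ≤-trans (≤-reflexive (*-identityʳ (suc weirds))) (≤-trans (≰⇒> big)
                                      (≤-reflexive (cong (z * z *_) (sym (*-identityˡ (deviation l A))))))

        -- A pure coordinate of another class is forced; at a weird coordinate the expected bit weighs z + 1
        -- and the deviating bit 1.
        bitWeight : ∀ {x} → Kind x → Bool → ℕ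
        bitWeight (inj₁ (i , _)) b with <-cmp (toℕ i) l | b
        ... | tri≈ _ _ _ | _     = 1
        ... | tri< _ _ _ | true  = 1
        ... | tri< _ _ _ | false = 0
        ... | tri> _ _ _ | true  = 0
        ... | tri> _ _ _ | false = 1
        bitWeight (inj₂ w) b = suc z ^ (1 ∸ deviates l (inj₂ w) b)

        column : ∀ {x} (κ : Kind x) →
          bitWeight κ true + bitWeight κ false ≡ 2 ^ pureAt l κ * suc (suc z) ^ weirdAt κ
        column (inj₁ (i , _)) with <-cmp (toℕ i) l
        ... | tri≈ _ eq _ rewrite 𝟙-yes (toℕ i ≟ l) eq = refl
        ... | tri< _ ne _ rewrite 𝟙-no (toℕ i ≟ l) ne  = refl
        ... | tri> _ ne _ rewrite 𝟙-no (toℕ i ≟ l) ne  = refl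
        column (inj₂ (s , _)) with s <? l
        ... | yes _ = e1 z
          where
          e1 : ∀ z → suc z * 1 + 1 ≡ 1 * (suc (suc z) * 1)
          e1 = solve-∀
        ... | no  _ = e1 z
          where
          e1 : ∀ z → 1 + suc z * 1 ≡ 1 * (suc (suc z) * 1)
          e1 = solve-∀

        -- The column sums are 2 at pure points of class `l`, 1 at other pure points and z + 2 at
        -- weird points, while every regular set weighs at least z^weirds. For z = 8k this bounds
        -- the regular sets by 2^(pures l) (1 + 1/4k)^weirds.
        regular-upper : Unique F → length regular * z ^ weirds ≤ 2 ^ pures l * suc (suc z) ^ weirds
        regular-upper uniq = begin
          length regular * z ^ weirds
            ≡⟨ ∑-const regular (z ^ weirds) ⟨
          ∑ regular (λ A → z ^ weirds)
            ≤⟨ ∑-mono regular heavy ⟩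
          ∑ regular (weight (λ x → bitWeight (kind x)))
            ≤⟨ ∑-unique-weight regular (Unique.filter⁺ regular? uniq) (λ x → bitWeight (kind x)) ⟩
          ∏ (allFin n) (λ x → bitWeight (kind x) true + bitWeight (kind x) false)
            ≡⟨ ∏-cong (allFin n) (λ x → column (kind x)) ⟩
          ∏ (allFin n) (λ x → 2 ^ pureAt l (kind x) * suc (suc z) ^ weirdAt (kind x))
            ≡⟨ ∏-* (allFin n) _ _ ⟩
          ∏ (allFin n) (λ x → 2 ^ pureAt l (kind x)) * ∏ (allFin n) (λ x → suc (suc z) ^ weirdAt (kind x))
            ≡⟨ cong₂ _*_ (∏-^ (allFin n) 2 _) (∏-^ (allFin n) (suc (suc z)) _) ⟩
          2 ^ pures l * suc (suc z) ^ weirds ∎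
          where
          open ≤-Reasoning
          heavy : ∀ A → A ∈ regular → z ^ weirds ≤ weight (λ x → bitWeight (kind x)) A
          heavy A A∈ with ∈-filter⁻ regular? {xs = F} A∈
          ... | A∈F , typ , ρ≡l , few = begin
            z ^ weirds
              ≡⟨ cong (z ^_) split ⟩
            z ^ (agree + deviation l A)
              ≤⟨ power-few-deviations z agree (deviation l A) 1≤z (≤-trans few (≤-reflexive split)) ⟩
            suc z ^ agree
              ≡⟨ ∏-^ (allFin n) (suc z) _ ⟨
            ∏ (allFin n) (λ x → suc z ^ (weirdAt (kind x) ∸ deviates l (kind x) (lookup A x)))
              ≤⟨ ∏-mono (allFin n) (λ x _ → bit x (kind x)) ⟩
            weight (λ x → bitWeight (kind x)) A ∎
            where
            agree : ℕ
            agree = ∑ (allFin n) (λ x → weirdAt (kind x) ∸ deviates l (kind x) (lookup A x))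
            split : weirds ≡ agree + deviation l A
            split = trans (∑-cong (allFin n) (λ x → sym (m∸n+n≡m (deviates≤weirdAt l (kind x) (lookup A x)))))
                          (∑-+ (allFin n) _ _)
            bit : ∀ x (κ : Kind x) → suc z ^ (weirdAt κ ∸ deviates l κ (lookup A x)) ≤ bitWeight κ (lookup A x)
            bit x (inj₂ w) = ≤-refl
            bit x (inj₁ (i , pure)) with <-cmp (toℕ i) l
            ... | tri≈ _ _ _ = ≤-refl
            ... | tri< i<l _ _ rewrite lookup≡true (proj₂ (pure A A∈F typ) (subst (toℕ i <_) (sym ρ≡l) i<l)) = ≤-refl
            ... | tri> _ _ l<i rewrite lookup≡false (proj₁ (pure A A∈F typ) (subst (_< toℕ i) (sym ρ≡l) l<i)) = ≤-refl

  -- Dimensions and cuts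

  -- Bernoulli's inequality (1 - 1/(N+1))^j ≥ 1 - j/(N+1), where `y` stands for N + 1 - j.
  bernoulli-down : ∀ N j y → y + j ≡ suc N → suc N ^ j * y ≤ suc N * N ^ j
  bernoulli-down N zero    y eq = ≤-reflexive (begin-equality
    1 * y      ≡⟨ *-identityˡ y ⟩
    y          ≡⟨ trans (sym (+-identityʳ y)) eq ⟩
    suc N      ≡⟨ *-identityʳ (suc N) ⟨
    suc N * 1  ∎)
    where open ≤-Reasoning
  bernoulli-down N (suc j) y eq = begin
    suc N * suc N ^ j * y       ≡⟨ e1 (suc N) (suc N ^ j) y ⟩
    suc N ^ j * (y + N * y)     ≤⟨ *-monoʳ-≤ (suc N ^ j) (+-monoˡ-≤ (N * y) y≤N) ⟩
    suc N ^ j * (N + N * y)     ≡⟨ e2 (suc N ^ j) N y ⟩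
    suc N ^ j * suc y * N       ≤⟨ *-monoˡ-≤ N (bernoulli-down N j (suc y) (trans (sym (+-suc y j)) eq)) ⟩
    suc N * N ^ j * N           ≡⟨ e3 (suc N) (N ^ j) N ⟩
    suc N * (N * N ^ j)         ∎
    where
    open ≤-Reasoning
    y≤N : y ≤ N
    y≤N = s≤s⁻¹ (≤-trans (s≤s (m≤m+n y j)) (≤-reflexive (trans (sym (+-suc y j)) eq)))
    e1 : ∀ s p y → s * p * y ≡ p * (s * y)
    e1 = solve-∀
    e2 : ∀ p N y → p * (N + N * y) ≡ p * suc y * N
    e2 = solve-∀
    e3 : ∀ s p N → s * p * N ≡ s * (N * p)
    e3 = solve-∀

  -- This is (1 + 1/4k)^k ≤ 4/3, the reason for z = 8k. Its reciprocal is at least 1 - k/(4k+1) =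
  -- (3k+1)/(4k+1) ≥ 3/4.
  ratio-upper : ∀ k → 1 ≤ k → 3 * suc (suc (8 * k)) ^ k ≤ 4 * (8 * k) ^ k
  ratio-upper k 1≤k = begin
    3 * suc (suc (8 * k)) ^ k          ≡⟨ cong (λ x → 3 * x ^ k) (e1 k) ⟩
    3 * (2 * suc N) ^ k                ≡⟨ trans (cong (3 *_) (^-distribʳ-* 2 (suc N) k)) (e2 3 (2 ^ k) (suc N ^ k)) ⟩
    2 ^ k * (3 * suc N ^ k)            ≤⟨ *-monoʳ-≤ (2 ^ k) (*-cancelˡ-≤ (suc N) scaled) ⟩
    2 ^ k * (4 * N ^ k)                ≡⟨ trans (cong (4 *_) (^-distribʳ-* 2 N k)) (e2 4 (2 ^ k) (N ^ k)) ⟨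
    4 * (2 * N) ^ k                    ≡⟨ cong (λ x → 4 * x ^ k) (e3 k) ⟩
    4 * (8 * k) ^ k                    ∎
    where
    open ≤-Reasoning
    N : ℕ
    N = 4 * k
    e1 : ∀ k → suc (suc (8 * k)) ≡ 2 * suc (4 * k)
    e1 = solve-∀
    e2 : ∀ c x y → c * (x * y) ≡ x * (c * y)
    e2 = solve-∀
    e3 : ∀ k → 2 * (4 * k) ≡ 8 * k
    e3 = solve-∀
    e4 : ∀ k x → suc (4 * k) * (3 * x) + x ≡ 4 * (x * (3 * k + 1))
    e4 = solve-∀
    e5 : ∀ k → 3 * k + 1 + k ≡ suc (4 * k)
    e5 = solve-∀
    scaled : suc N * (3 * suc N ^ k) ≤ suc N * (4 * N ^ k)
    scaled = begin
      suc N * (3 * suc N ^ k)              ≤⟨ m≤m+n _ (suc N ^ k) ⟩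
      suc N * (3 * suc N ^ k) + suc N ^ k  ≡⟨ e4 k (suc N ^ k) ⟩
      4 * (suc N ^ k * (3 * k + 1))        ≤⟨ *-monoʳ-≤ 4 (bernoulli-down N k (3 * k + 1) (e5 k)) ⟩
      4 * (suc N * N ^ k)                  ≡⟨ e2 4 (suc N) (N ^ k) ⟩
      suc N * (4 * N ^ k)                  ∎

  -- This is (1 - 1/4k)^k ≥ 1 - k/4k = 3/4, the total loss when every class may lack a 1/4k fraction
  -- of 2^d.
  ratio-lower : ∀ k N → 1 ≤ k → 4 * k ≡ suc N → 3 * suc N ^ k ≤ 4 * N ^ k
  ratio-lower k N 1≤k 4k≡ = *-cancelˡ-≤ k {{>-nonZero 1≤k}} (begin
    k * (3 * suc N ^ k)      ≡⟨ e1 k (suc N ^ k) ⟩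
    suc N ^ k * (3 * k)      ≤⟨ bernoulli-down N k (3 * k) (trans (e2 k) 4k≡) ⟩
    suc N * N ^ k            ≡⟨ cong (_* N ^ k) (sym 4k≡) ⟩
    4 * k * N ^ k            ≡⟨ e3 k (N ^ k) ⟩
    k * (4 * N ^ k)          ∎)
    where
    open ≤-Reasoning
    e1 : ∀ k x → k * (3 * x) ≡ x * (3 * k)
    e1 = solve-∀
    e2 : ∀ k → 3 * k + k ≡ 4 * k
    e2 = solve-∀
    e3 : ∀ k x → 4 * k * x ≡ k * (4 * x)
    e3 = solve-∀

  ^-swap : ∀ x q k → (x ^ q) ^ k ≡ (x ^ k) ^ q
  ^-swap x q k = trans (^-*-assoc x q k) (trans (cong (x ^_) (*-comm q k)) (sym (^-*-assoc x k q)))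

  ∑≡k*d⇒≡d : ∀ k d (R : Fin k → ℕ) → (∀ i → d ≤ R i) → ∑ (allFin k) R ≡ k * d → ∀ i → R i ≡ d
  ∑≡k*d⇒≡d k d R d≤R ∑R≡ i = ≤-antisym (m∸n≡0⇒m≤n (n≤0⇒n≡0 (≤-trans (f≤∑ (allFin k) (λ j → R j ∸ d) (∈-allFin i)) (≤-reflexive excess)))) (d≤R i)
    where
    open ≡-Reasoning
    excess : ∑ (allFin k) (λ j → R j ∸ d) ≡ 0
    excess = +-cancelʳ-≡ (k * d) _ 0 (begin
      ∑ (allFin k) (λ j → R j ∸ d) + k * d
        ≡⟨ cong (∑ (allFin k) (λ j → R j ∸ d) +_) (trans (∑-const (allFin k) d) (cong (_* d) (length-tabulate {n = k} (λ j → j)))) ⟨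
      ∑ (allFin k) (λ j → R j ∸ d) + ∑ (allFin k) (λ j → d)
        ≡⟨ ∑-+ (allFin k) _ _ ⟨
      ∑ (allFin k) (λ j → R j ∸ d + d)
        ≡⟨ ∑-cong (allFin k) (λ j → m∸n+n≡m (d≤R j)) ⟩
      ∑ (allFin k) R
        ≡⟨ ∑R≡ ⟩
      k * d ∎)

  module Dimensions (k d q : ℕ) (g R : Fin k → ℕ) (1≤k : 1 ≤ k)
    (upper : ∀ i → g i * (8 * k) ^ q ≤ 2 ^ R i * suc (suc (8 * k)) ^ q)
    (lower : ∀ i → 4 * k * 2 ^ d ≤ 4 * k * g i + 2 ^ d)
    (total : ∑ (allFin k) R + q ≡ k * d) where

    open ≤-Reasoning

    private
      I : List (Fin k)
      I = allFin k
      G D r z y N : ℕ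
      G = ∏ I g
      D = 2 ^ d
      r = 2 ^ ∑ I R
      z = 8 * k
      y = suc (suc (8 * k))
      N = 4 * k ∸ 1

      4k≡ : 4 * k ≡ suc N
      4k≡ = sym (m+[n∸m]≡n (*-mono-≤ (s≤s {n = 3} z≤n) 1≤k))

      ∏-const-I : ∀ c → ∏ I (λ _ → c) ≡ c ^ k
      ∏-const-I c = trans (∏-const I c) (cong (c ^_) (length-tabulate {n = k} (λ i → i)))

      product-upper : G * 3 ^ q ≤ r * 4 ^ q
      product-upper = *-cancelʳ-≤ _ _ ((z ^ k) ^ q) {{m^n≢0 (z ^ k) q {{m^n≢0 z k {{>-nonZero (*-mono-≤ (s≤s {n = 7} z≤n) 1≤k)}}}}}} (begin
        G * 3 ^ q * (z ^ k) ^ q              ≡⟨ e1 G (3 ^ q) ((z ^ k) ^ q) ⟩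
        3 ^ q * (G * (z ^ k) ^ q)            ≤⟨ *-monoʳ-≤ (3 ^ q) multiplied ⟩
        3 ^ q * (r * (y ^ k) ^ q)            ≡⟨ e2 (3 ^ q) r ((y ^ k) ^ q) ⟩
        r * (3 ^ q * (y ^ k) ^ q)            ≡⟨ cong (r *_) (^-distribʳ-* 3 (y ^ k) q) ⟨
        r * (3 * y ^ k) ^ q                  ≤⟨ *-monoʳ-≤ r (^-monoˡ-≤ q (ratio-upper k 1≤k)) ⟩
        r * (4 * z ^ k) ^ q                  ≡⟨ cong (r *_) (^-distribʳ-* 4 (z ^ k) q) ⟩
        r * (4 ^ q * (z ^ k) ^ q)            ≡⟨ *-assoc r (4 ^ q) _ ⟨
        r * 4 ^ q * (z ^ k) ^ q              ∎)
        where
        e1 : ∀ a b c → a * b * c ≡ b * (a * c)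
        e1 = solve-∀
        e2 : ∀ a b c → a * (b * c) ≡ b * (a * c)
        e2 = solve-∀
        multiplied : G * (z ^ k) ^ q ≤ r * (y ^ k) ^ q
        multiplied = begin
          G * (z ^ k) ^ q                       ≡⟨ cong (G *_) (trans (^-swap z k q) (sym (∏-const-I (z ^ q)))) ⟩
          G * ∏ I (λ _ → z ^ q)                 ≡⟨ ∏-* I g _ ⟨
          ∏ I (λ i → g i * z ^ q)               ≤⟨ ∏-mono I (λ i _ → upper i) ⟩
          ∏ I (λ i → 2 ^ R i * y ^ q)           ≡⟨ ∏-* I _ _ ⟩
          ∏ I (λ i → 2 ^ R i) * ∏ I (λ _ → y ^ q) ≡⟨ cong₂ _*_ (∏-^ I 2 R) (trans (∏-const-I (y ^ q)) (^-swap y q k)) ⟩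
          r * (y ^ k) ^ q                       ∎

      product-lower : 3 * D ^ k ≤ 4 * G
      product-lower = *-cancelˡ-≤ (suc N ^ k) {{m^n≢0 (suc N) k}} (begin
        suc N ^ k * (3 * D ^ k)               ≡⟨ e1 (suc N ^ k) (D ^ k) ⟩
        3 * suc N ^ k * D ^ k                 ≤⟨ *-monoˡ-≤ (D ^ k) (ratio-lower k N 1≤k 4k≡) ⟩
        4 * N ^ k * D ^ k                     ≡⟨ trans (*-assoc 4 (N ^ k) (D ^ k)) (cong (4 *_) (sym (^-distribʳ-* N D k))) ⟩
        4 * (N * D) ^ k                       ≡⟨ cong (4 *_) (∏-const-I (N * D)) ⟨
        4 * ∏ I (λ _ → N * D)                 ≤⟨ *-monoʳ-≤ 4 (∏-mono I (λ i _ → low i)) ⟩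
        4 * ∏ I (λ i → suc N * g i)           ≡⟨ cong (4 *_) (trans (∏-* I _ g) (cong (_* G) (∏-const-I (suc N)))) ⟩
        4 * (suc N ^ k * G)                   ≡⟨ e2 (suc N ^ k) G ⟩
        suc N ^ k * (4 * G)                   ∎)
        where
        e1 : ∀ x y → x * (3 * y) ≡ 3 * x * y
        e1 = solve-∀
        e2 : ∀ x y → 4 * (x * y) ≡ x * (4 * y)
        e2 = solve-∀
        low : ∀ i → N * D ≤ suc N * g i
        low i = +-cancelˡ-≤ D _ _ (begin
          suc N * D             ≡⟨ cong (_* D) 4k≡ ⟨
          4 * k * D             ≤⟨ lower i ⟩
          4 * k * g i + D       ≡⟨ trans (+-comm _ D) (cong (λ x → D + x * g i) 4k≡) ⟩
          D + suc N * g i       ∎)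

      -- Comparing (3/4) 2^(kd) ≤ ∏ g ≤ 2^(kd - q) (4/3)^q leaves 3/4 ≤ (2/3)^q.
      six-four : 3 * 6 ^ q ≤ 4 * 4 ^ q
      six-four = *-cancelˡ-≤ r {{m^n≢0 2 (∑ I R)}} (begin
        r * (3 * 6 ^ q)                     ≡⟨ cong (λ x → r * (3 * x)) (^-distribʳ-* 2 3 q) ⟩
        r * (3 * (2 ^ q * 3 ^ q))           ≡⟨ e1 r (2 ^ q) (3 ^ q) ⟩
        3 * (r * 2 ^ q) * 3 ^ q             ≡⟨ cong (λ x → 3 * x * 3 ^ q) size ⟩
        3 * D ^ k * 3 ^ q                   ≤⟨ *-monoˡ-≤ (3 ^ q) product-lower ⟩
        4 * G * 3 ^ q                       ≡⟨ *-assoc 4 G (3 ^ q) ⟩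
        4 * (G * 3 ^ q)                     ≤⟨ *-monoʳ-≤ 4 product-upper ⟩
        4 * (r * 4 ^ q)                     ≡⟨ e2 r (4 ^ q) ⟩
        r * (4 * 4 ^ q)                     ∎)
        where
        e1 : ∀ r x y → r * (3 * (x * y)) ≡ 3 * (r * x) * y
        e1 = solve-∀
        e2 : ∀ r x → 4 * (r * x) ≡ r * (4 * x)
        e2 = solve-∀
        size : r * 2 ^ q ≡ D ^ k
        size = begin-equality
          r * 2 ^ q          ≡⟨ ^-distribˡ-+-* 2 (∑ I R) q ⟨
          2 ^ (∑ I R + q)    ≡⟨ cong (2 ^_) (trans total (*-comm k d)) ⟩
          2 ^ (d * k)        ≡⟨ ^-*-assoc 2 d k ⟨
          D ^ k              ∎

      q≡0-from : ∀ q′ → 3 * 6 ^ q′ ≤ 4 * 4 ^ q′ → q′ ≡ 0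
      q≡0-from zero     le = refl
      -- One weird point is already too many, as 3 · 6 > 4 · 4.
      q≡0-from (suc q′) le = contradiction (begin
          18 * 4 ^ q′               ≤⟨ *-monoʳ-≤ 18 (^-monoˡ-≤ q′ (s≤s (s≤s (s≤s (s≤s (z≤n {2})))))) ⟩
          18 * 6 ^ q′               ≡⟨ *-assoc 3 6 (6 ^ q′) ⟩
          3 * (6 * 6 ^ q′)          ≤⟨ le ⟩
          4 * (4 * 4 ^ q′)          ≡⟨ *-assoc 4 4 (4 ^ q′) ⟨
          16 * 4 ^ q′               ∎)
        (<⇒≱ (*-monoˡ-< (4 ^ q′) {{m^n≢0 4 q′}} (s≤s (m≤m+n 16 1))))

    no-weird : q ≡ 0
    no-weird = q≡0-from q six-four

    dimensions : ∀ i → R i ≡ d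
    dimensions = ∑≡k*d⇒≡d k d R d≤R (trans (sym (trans (cong (∑ I R +_) no-weird) (+-identityʳ _))) total)
      where
      d≤R : ∀ i → d ≤ R i
      d≤R i with d ≤? R i
      ... | yes d≤R = d≤R
      -- With one dimension missing, the class would be at most half as large as 2^d, but it may
      -- lack only a 1/4k fraction.
      ... | no  d≰R = contradiction too-small (<⇒≱ (*-monoˡ-< (k * D) {{m*n≢0 k D {{>-nonZero 1≤k}} {{m^n≢0 2 d}}}} (s≤s (m≤m+n 6 1))))
        where
        g≤ : g i ≤ 2 ^ R i
        g≤ = begin
          g i                        ≡⟨ *-identityʳ (g i) ⟨
          g i * z ^ 0                ≡⟨ cong (λ x → g i * z ^ x) no-weird ⟨
          g i * z ^ q                ≤⟨ upper i ⟩
          2 ^ R i * y ^ q            ≡⟨ cong (λ x → 2 ^ R i * y ^ x) no-weird ⟩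
          2 ^ R i * 1                ≡⟨ *-identityʳ _ ⟩
          2 ^ R i                    ∎
        half : 2 * 2 ^ R i ≤ D
        half = ^-monoʳ-≤ 2 (≰⇒> d≰R)
        too-small : 8 * (k * D) ≤ 6 * (k * D)
        too-small = begin
          8 * (k * D)                   ≡⟨ e1 k D ⟩
          2 * (4 * k * D)               ≤⟨ *-monoʳ-≤ 2 (lower i) ⟩
          2 * (4 * k * g i + D)         ≤⟨ *-monoʳ-≤ 2 (+-monoˡ-≤ D (*-monoʳ-≤ (4 * k) g≤)) ⟩
          2 * (4 * k * 2 ^ R i + D)     ≡⟨ e2 k (2 ^ R i) D ⟩
          4 * k * (2 * 2 ^ R i) + 2 * (1 * D)   ≤⟨ +-mono-≤ (*-monoʳ-≤ (4 * k) half) (*-monoʳ-≤ 2 (*-monoˡ-≤ D 1≤k)) ⟩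
          4 * k * D + 2 * (k * D)       ≡⟨ e3 k D ⟩
          6 * (k * D)                   ∎
          where
          e1 : ∀ k D → 8 * (k * D) ≡ 2 * (4 * k * D)
          e1 = solve-∀
          e2 : ∀ k x D → 2 * (4 * k * x + D) ≡ 4 * k * (2 * x) + 2 * (1 * D)
          e2 = solve-∀
          e3 : ∀ k D → 4 * k * D + 2 * (k * D) ≡ 6 * (k * D)
          e3 = solve-∀

  module Cuts {n k : ℕ} (index : Fin n → Fin k) where

    cut : ℕ → Subset n
    cut j = tabulate (λ x → does (toℕ (index x) <? j))

    ∈-cut⁺ : ∀ {j x} → toℕ (index x) < j → x ∈ˢ cut j
    ∈-cut⁺ {j} {x} lt = lookup⇒[]= x (cut j) (trans (lookup∘tabulate _ x) (dec-true (toℕ (index x) <? j) lt))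

    ∈-cut⁻ : ∀ {j x} → x ∈ˢ cut j → toℕ (index x) < j
    ∈-cut⁻ {j} {x} x∈ = <ᵇ⇒< (toℕ (index x)) j
      (subst T (sym (trans (sym (lookup∘tabulate (λ x → does (toℕ (index x) <? j)) x)) ([]=⇒lookup x∈))) tt)

    module _ (d : ℕ) (sizes : ∀ (i : Fin k) → ∑ (allFin n) (λ x → 𝟙 (toℕ (index x) ≟ toℕ i)) ≡ d) where

      ∣cut∣-suc : ∀ (i : Fin k) → ∣ cut (suc (toℕ i)) ∣ ≡ ∣ cut (toℕ i) ∣ + d
      ∣cut∣-suc i = begin-equality
        ∣ cut (suc l) ∣
          ≡⟨ ∣∣≡∑ (cut (suc l)) ⟩
        ∑ (allFin n) (λ x → 𝟙 (x ∈? cut (suc l)))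
          ≡⟨ ∑-cong (allFin n) layer ⟩
        ∑ (allFin n) (λ x → 𝟙 (x ∈? cut l) + 𝟙 (toℕ (index x) ≟ l))
          ≡⟨ ∑-+ (allFin n) _ _ ⟩
        ∑ (allFin n) (λ x → 𝟙 (x ∈? cut l)) + ∑ (allFin n) (λ x → 𝟙 (toℕ (index x) ≟ l))
          ≡⟨ cong₂ _+_ (sym (∣∣≡∑ (cut l))) (sizes i) ⟩
        ∣ cut l ∣ + d ∎
        where
        open ≤-Reasoning
        l : ℕ
        l = toℕ i
        layer : ∀ x → 𝟙 (x ∈? cut (suc l)) ≡ 𝟙 (x ∈? cut l) + 𝟙 (toℕ (index x) ≟ l)
        layer x = ≤-antisym
          (𝟙-cover (x ∈? cut (suc l)) (x ∈? cut l) (toℕ (index x) ≟ l)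
            (λ x∈ → [ (λ lt → inj₁ (∈-cut⁺ lt)) , inj₂ ] (m≤n⇒m<n∨m≡n (s≤s⁻¹ (∈-cut⁻ x∈)))))
          (𝟙-disjoint (x ∈? cut l) (toℕ (index x) ≟ l) (x ∈? cut (suc l))
            (λ x∈ eq → <⇒≢ (∈-cut⁻ x∈) eq)
            (λ x∈ → ∈-cut⁺ (m≤n⇒m≤1+n (∈-cut⁻ x∈)))
            (λ eq → ∈-cut⁺ (s≤s (≤-reflexive eq))))

      cutTower : Tower n k d
      cutTower = record
        { X       = λ j → cut (toℕ j)
        ; X-first = ⊆-antisym (λ x∈ → contradiction (∈-cut⁻ x∈) n≮0) ⊥⊆
        ; X-last  = ⊆-antisym ⊆⊤ (λ {x} _ → ∈-cut⁺ (≤-trans (toℕ<n (index x)) (≤-reflexive (sym (toℕ-fromℕ k)))))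
        ; X-mono  = λ i x∈ → ∈-cut⁺ (m≤n⇒m≤1+n (≤-trans (∈-cut⁻ x∈) (≤-reflexive (toℕ-inject₁ i))))
        ; X-step  = λ i → trans (∣cut∣-suc i) (cong (λ j → ∣ cut j ∣ + d) (sym (toℕ-inject₁ i)))
        }

      in-cutTower : ∀ (i : Fin k) A → (∀ x → toℕ (index x) < toℕ i → x ∈ˢ A) →
        (∀ x → toℕ i < toℕ (index x) → ¬ x ∈ˢ A) → InTower cutTower A
      in-cutTower i A inside outside = i ,
        (λ {x} x∈ → inside x (≤-trans (∈-cut⁻ x∈) (≤-reflexive (toℕ-inject₁ i)))) ,
        (λ {x} x∈A → ∈-cut⁺ (s≤s (≮⇒≥ (λ lt → outside x lt x∈A))))

  -- Choice of constants

  n≤2^n : ∀ x → x ≤ 2 ^ x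
  n≤2^n zero    = z≤n
  n≤2^n (suc x) = +-mono-≤ (m^n>0 2 x) (≤-trans (n≤2^n x) (≤-reflexive (sym (+-identityʳ (2 ^ x)))))

  -- Both sources of bad sets get half of the allowance m / Q: the top class because 2Q ≤ b, the
  -- sets of large defect because S = 2 a Q.
  bad-small : ∀ Q a S b m bad top V → S ≡ 2 * (a * Q) → 1 ≤ a → 2 * Q ≤ b → 1 ≤ S → 1 ≤ m →
    m * bad ≤ m * top + a * (2 * V) → b * top ≤ m → S * S * (2 * V) ≤ m * m → Q * bad ≤ m
  bad-small Q a S b m bad top V refl 1≤a 2Q≤b 1≤S 1≤m count top≤ few =
    *-cancelˡ-≤ (2 * m) {{>-nonZero (*-mono-≤ (s≤s {n = 1} z≤n) 1≤m)}} (begin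
      2 * m * (Q * bad)                          ≡⟨ e1 m Q bad ⟩
      2 * Q * (m * bad)                          ≤⟨ *-monoʳ-≤ (2 * Q) count ⟩
      2 * Q * (m * top + a * (2 * V))            ≡⟨ e2 Q m top a (2 * V) ⟩
      m * (2 * Q * top) + 1 * (S * (2 * V))      ≤⟨ +-mono-≤ (*-monoʳ-≤ m (≤-trans (*-monoˡ-≤ top 2Q≤b) top≤)) (*-monoˡ-≤ (S * (2 * V)) 1≤S) ⟩
      m * m + S * (S * (2 * V))                  ≤⟨ +-monoʳ-≤ (m * m) (≤-trans (≤-reflexive (sym (*-assoc S S (2 * V)))) few) ⟩
      m * m + m * m                              ≡⟨ e3 m ⟩
      2 * m * m                                  ∎)
    where
    open ≤-Reasoning
    e1 : ∀ m Q x → 2 * m * (Q * x) ≡ 2 * Q * (m * x)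
    e1 = solve-∀
    e2 : ∀ Q m t a V → 2 * Q * (m * t + a * V) ≡ m * (2 * Q * t) + 1 * (2 * (a * Q) * V)
    e2 = solve-∀
    e3 : ∀ m → m * m + m * m ≡ 2 * m * m
    e3 = solve-∀

  -- With K = 32k, the relative losses are: 1/K from `size`, 1/K from `class≥`, and 2/K for the bad
  -- and the wild members. Hence k g ≥ (1 - 3/K)(1 - 1/K) k D, well above the required (1 - 8/K) k
  -- D.
  regular-large : ∀ k M y y′ m D g c bad → 1 ≤ k → 1 ≤ M → 1 ≤ y → 1 ≤ y′ →
    32 * (k * k) * M * c ≤ 32 * (k * k) * M * g + 32 * (k * k) * M * bad + M * m →
    32 * (k * k) * bad ≤ m →
    32 * k * y * m ≤ 32 * k * y * (k * c) + m →
    32 * k * y′ * (k * D) ≤ 32 * k * y′ * m + k * D →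
    4 * k * D ≤ 4 * k * g + D
  regular-large k M y y′ m D g c bad 1≤k 1≤M 1≤y 1≤y′ lower bad≤ class≥ size = *-cancelˡ-≤ (8 * k * K) {{8kK≢0}} (begin
    8 * k * K * (4 * k * D)
      ≡⟨ cong (λ x → 8 * k * x * (4 * k * D)) K≡ ⟩
    8 * k * (j + 3) * (4 * k * D)
      ≡⟨ e1 k j D ⟩
    (j + 3) * (32 * k * (k * D))
      ≡⟨ cong (λ x → (j + 3) * (x * (k * D))) K≡ ⟩
    (j + 3) * ((j + 3) * (k * D))
      ≡⟨ e2 j (k * D) ⟩
    j * ((j + 3) * (k * D)) + 3 * (j + 3) * (k * D)
      ≤⟨ +-monoˡ-≤ _ (*-monoʳ-≤ j (≤-trans (≤-reflexive (cong (_* (k * D)) (sym K≡))) size′)) ⟩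
    j * (K * m + k * D) + 3 * (j + 3) * (k * D)
      ≡⟨ e3 j K m (k * D) ⟩
    K * (j * m) + (j + 3 * (j + 3)) * (k * D)
      ≤⟨ +-mono-≤ (*-monoʳ-≤ K jm≤) (*-monoˡ-≤ (k * D) (≤-trans (m≤m+n (j + 3 * (j + 3)) (4 * j + 15)) (≤-reflexive (e4 j)))) ⟩
    K * (32 * (k * k) * g) + 8 * (j + 3) * (k * D)
      ≡⟨ cong (λ x → K * (32 * (k * k) * g) + 8 * x * (k * D)) (sym K≡) ⟩
    K * (32 * (k * k) * g) + 8 * K * (k * D)
      ≡⟨ e5 k K g D ⟩
    8 * k * K * (4 * k * g + D) ∎)
    where
    open ≤-Reasoning
    K j : ℕ
    K = 32 * k
    -- K - 3 is the numerator left after the losses between m and k g.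
    j = K ∸ 3
    K≥3 : 3 ≤ K
    K≥3 = ≤-trans (s≤s (s≤s (s≤s (z≤n {29})))) (*-monoʳ-≤ 32 1≤k)
    K≡ : K ≡ j + 3
    K≡ = sym (m∸n+n≡m K≥3)
    8kK≢0 : NonZero (8 * k * K)
    8kK≢0 = >-nonZero (*-mono-≤ (*-mono-≤ (s≤s {n = 7} z≤n) 1≤k) (≤-trans (s≤s (z≤n {2})) K≥3))
    e1 : ∀ k j D → 8 * k * (j + 3) * (4 * k * D) ≡ (j + 3) * (32 * k * (k * D))
    e1 = solve-∀
    e2 : ∀ j x → (j + 3) * ((j + 3) * x) ≡ j * ((j + 3) * x) + 3 * (j + 3) * x
    e2 = solve-∀
    e3 : ∀ j K m x → j * (K * m + x) + 3 * (j + 3) * x ≡ K * (j * m) + (j + 3 * (j + 3)) * x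
    e3 = solve-∀
    e4 : ∀ j → j + 3 * (j + 3) + (4 * j + 15) ≡ 8 * (j + 3)
    e4 = solve-∀
    e5 : ∀ k K g D → K * (32 * (k * k) * g) + 8 * K * (k * D) ≡ 8 * k * K * (4 * k * g + D)
    e5 = solve-∀
    e6 : ∀ K y x → K * y * x ≡ y * (K * x)
    e6 = solve-∀
    e7 : ∀ P M x → P * M * x ≡ M * (P * x)
    e7 = solve-∀
    cancel-scale : ∀ u A B C → 1 ≤ u → K * u * A ≤ K * u * B + C → K * A ≤ K * B + C
    cancel-scale u A B C 1≤u le = *-cancelˡ-≤ u {{>-nonZero 1≤u}} (begin
      u * (K * A)          ≡⟨ e6 K u A ⟨
      K * u * A            ≤⟨ le ⟩
      K * u * B + C        ≤⟨ +-mono-≤ (≤-reflexive (e6 K u B)) (≤-trans (≤-reflexive (sym (*-identityˡ C))) (*-monoˡ-≤ C 1≤u)) ⟩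
      u * (K * B) + u * C  ≡⟨ *-distribˡ-+ u (K * B) C ⟨
      u * (K * B + C)      ∎)
    size′ : K * (k * D) ≤ K * m + k * D
    size′ = cancel-scale y′ (k * D) m (k * D) 1≤y′ size
    class≤ : 32 * (k * k) * c ≤ 32 * (k * k) * g + 2 * m
    class≤ = *-cancelˡ-≤ M {{>-nonZero 1≤M}} (begin
      M * (c₀ * c)                          ≡⟨ e7 c₀ M c ⟨
      c₀ * M * c                            ≤⟨ lower ⟩
      c₀ * M * g + c₀ * M * bad + M * m      ≡⟨ e8 c₀ M g bad m ⟩
      M * (c₀ * g + (c₀ * bad + m))          ≤⟨ *-monoʳ-≤ M (+-monoʳ-≤ (c₀ * g) (+-monoˡ-≤ m bad≤)) ⟩
      M * (c₀ * g + (m + m))                ≡⟨ cong (λ x → M * (c₀ * g + (m + x))) (+-identityʳ m) ⟨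
      M * (c₀ * g + 2 * m)                  ∎)
      where
      c₀ : ℕ
      c₀ = 32 * (k * k)
      e8 : ∀ P M g b m → P * M * g + P * M * b + M * m ≡ M * (P * g + (P * b + m))
      e8 = solve-∀
    jm≤ : j * m ≤ 32 * (k * k) * g
    jm≤ = +-cancelʳ-≤ (3 * m) _ _ (begin
      j * m + 3 * m                     ≡⟨ *-distribʳ-+ m j 3 ⟨
      (j + 3) * m                       ≡⟨ cong (_* m) K≡ ⟨
      K * m                             ≤⟨ cancel-scale y m (k * c) m 1≤y class≥ ⟩
      K * (k * c) + m                   ≡⟨ e9 k c m ⟩
      32 * (k * k) * c + m              ≤⟨ +-monoˡ-≤ m class≤ ⟩
      32 * (k * k) * g + 2 * m + m      ≡⟨ e10 (32 * (k * k) * g) m ⟩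
      32 * (k * k) * g + 3 * m          ∎)
      where
      e9 : ∀ k c m → 32 * k * (k * c) + m ≡ 32 * (k * k) * c + m
      e9 = solve-∀
      e10 : ∀ x m → x + 2 * m + m ≡ x + 3 * m
      e10 = solve-∀

  -- As k ≥ 2, the main term k D contains a second copy of D, which absorbs the loss k D / H ≤ D.
  2^d≤size : ∀ k H D m → 2 ≤ k → 1 ≤ H → k ≤ H → H * (k * D) ≤ H * m + k * D → D ≤ m
  2^d≤size k H D m 2≤k 1≤H k≤H le = *-cancelˡ-≤ H {{>-nonZero 1≤H}} (+-cancelʳ-≤ (H * D) _ _ (begin
    H * D + H * D           ≡⟨ e1 H D ⟩
    H * (2 * D)             ≤⟨ *-monoʳ-≤ H (*-monoˡ-≤ D 2≤k) ⟩
    H * (k * D)             ≤⟨ le ⟩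
    H * m + k * D           ≤⟨ +-monoʳ-≤ (H * m) (*-monoˡ-≤ D k≤H) ⟩
    H * m + H * D           ∎))
    where
    open ≤-Reasoning
    e1 : ∀ H D → H * D + H * D ≡ H * (2 * D)
    e1 = solve-∀

  -- The tower for given constants

  module Stability {n : ℕ} (F : List (Subset n)) (uniq : Unique F) (k d E a Q S H b y y′ p : ℕ)
    (n≡ : n ≡ k * d) (1≤k : 1 ≤ k) (1≤E : 1 ≤ E) (1≤a : 1 ≤ a) (1≤S : 1 ≤ S) (1≤y : 1 ≤ y) (1≤y′ : 1 ≤ y′) (1≤m : 1 ≤ length F)
    (a≡ : a ≡ 32 * (k * k) * (8 * k * (8 * k))) (Q≡ : Q ≡ 32 * (k * k) * E)
    (S≡2aQ : S ≡ 2 * (a * Q)) (S≡ : S ≡ 32 * k * y) (H≡4kSS : H ≡ 4 * k * (S * S)) (H≡ : H ≡ 32 * k * y′)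
    (b≥ : 32 * (k * k) * (S * S) ≤ b) (2Q≤b : 2 * Q ≤ b) (m≥ : 4 * (k * k) * (S * S) ≤ length F)
    (few-high : b * Levels.below F b k ⊤ ≤ length F)
    (size : H * (k * 2 ^ d) ≤ H * length F + k * 2 ^ d)
    (p+m≡ : p + length F ≡ length F * length F)
    (dense : k * H * p ≤ 2 * (k * H * comparablePairs F) + suc H * p) where

    private
      m z : ℕ
      m = length F
      z = 8 * k
      ρ : Subset n → ℕ
      ρ = rank F b k
      ρ≤k : ∀ A → ρ A ≤ k
      ρ≤k = rank≤ F b k

    open Classes F k ρ ρ≤k hiding (m)
    open TypicalSets F k ρ ρ≤k a

    private
      top-small : b * class k ≤ m
      top-small = few-top F b k few-high

      bad-Q : Q * length bad ≤ m
      bad-Q = bad-small Q a S b m (length bad) (class k) violations S≡2aQ 1≤a 2Q≤b 1≤S 1≤m bad-count top-small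
        (few-violations b H S p 1≤k 1≤S (few-below F b k) top-small H≡4kSS b≥ m≥ p+m≡ dense)

      1≤P : 1 ≤ 32 * (k * k)
      1≤P = *-mono-≤ (s≤s {n = 31} z≤n) (*-mono-≤ 1≤k 1≤k)

      1≤z : 1 ≤ z
      1≤z = *-mono-≤ (s≤s {n = 7} z≤n) 1≤k

      bad-P : 32 * (k * k) * length bad ≤ m
      bad-P = ≤-trans (*-monoˡ-≤ (length bad) (begin
        32 * (k * k)       ≡⟨ *-identityʳ (32 * (k * k)) ⟨
        32 * (k * k) * 1   ≤⟨ *-monoʳ-≤ (32 * (k * k)) 1≤E ⟩
        32 * (k * k) * E   ≡⟨ Q≡ ⟨
        Q                  ∎)) bad-Q
        where open ≤-Reasoning

      bad-E : E * length bad ≤ m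
      bad-E = ≤-trans (*-monoˡ-≤ (length bad) (begin
        E                  ≡⟨ *-identityˡ E ⟨
        1 * E              ≤⟨ *-monoˡ-≤ E 1≤P ⟩
        32 * (k * k) * E   ≡⟨ Q≡ ⟨
        Q                  ∎)) bad-Q
        where open ≤-Reasoning

    Covered : Tower n k d → Set
    Covered T = Σ (List (Subset n)) λ Bad →
      (E * length Bad ≤ length F) × ((A : Subset n) → A ∈ F → A ∈ Bad ⊎ InTower T A)

    covered-by-cuts : (index : Fin n → Fin k) → (∀ x → Pure (toℕ (index x)) x) →
      (∀ i → ∑ (allFin n) (λ x → 𝟙 (toℕ (index x) ≟ toℕ i)) ≡ d) → Σ (Tower n k d) Covered
    covered-by-cuts index pure sizes = cutTower d sizes , bad , bad-E , λ A A∈F → cases A A∈F (typical? A)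
      where
      open Cuts index
      cases : ∀ A → A ∈ F → Dec (Typical A) → A ∈ bad ⊎ InTower (cutTower d sizes) A
      cases A A∈F (no atypical)       = inj₁ (∈-filter⁺ (λ B → ¬? (typical? B)) A∈F atypical)
      -- The rank of a typical set names its cube: points of smaller index lie in it, points of
      -- larger index do not.
      cases A A∈F (yes typ@(ρ<k , _)) = inj₂ (in-cutTower d sizes (fromℕ< ρ<k) A
        (λ x lt → proj₂ (pure x A A∈F typ) (subst (toℕ (index x) <_) (toℕ-fromℕ< ρ<k) lt))
        (λ x lt → proj₁ (pure x A A∈F typ) (subst (_< toℕ (index x)) (toℕ-fromℕ< ρ<k) lt)))

    module _ (kind : ∀ x → Kind x) where
      open WithKinds kind

      reg : Fin k → ℕ
      reg i = length (regular z 1≤z (toℕ i) (toℕ<n i))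

      reg-large : ∀ i → 4 * k * 2 ^ d ≤ 4 * k * reg i + 2 ^ d
      reg-large i = regular-large k (z * z) y y′ m (2 ^ d) (reg i) (class (toℕ i)) (length bad) 1≤k (*-mono-≤ 1≤z 1≤z) 1≤y 1≤y′
        (subst (λ x → x * class (toℕ i) ≤ x * reg i + x * length bad + z * z * m) a≡ (regular-lower z 1≤z (toℕ i) (toℕ<n i))) bad-P
        (subst (λ s → s * m ≤ s * (k * class (toℕ i)) + m) S≡
          (class-large b H S p 1≤k 1≤S (few-below F b k) top-small H≡4kSS b≥ m≥ p+m≡ dense i))
        (subst (λ h → h * (k * 2 ^ d) ≤ h * m + k * 2 ^ d) H≡ size)

      reg-small : ∀ i → reg i * (8 * k) ^ weirds ≤ 2 ^ pures (toℕ i) * suc (suc (8 * k)) ^ weirds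
      reg-small i = regular-upper z 1≤z (toℕ i) (toℕ<n i) uniq

      weirds≡0 : weirds ≡ 0
      weirds≡0 = Dimensions.no-weird k d weirds reg (λ i → pures (toℕ i)) 1≤k reg-small reg-large (trans pures+weirds n≡)

      pures≡d : ∀ i → pures (toℕ i) ≡ d
      pures≡d = Dimensions.dimensions k d weirds reg (λ i → pures (toℕ i)) 1≤k reg-small reg-large (trans pures+weirds n≡)

      covered : Σ (Tower n k d) Covered
      covered = covered-by-cuts (indexOf weirds≡0) (indexOf-pure weirds≡0)
        (λ i → trans (indexOf-size weirds≡0 (toℕ i)) (pures≡d i))

    tower-stability : Σ (Tower n k d) Covered
    tower-stability = covered (classify 1≤k)

  -- 1/E bounds ε and 1/H is η. The levels use the threshold b = 2^β, a set is typical if it violates at most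
  -- m / a pairs, and the class sizes and violations deviate from the extremal structure by at most (m / S)².
  module Constants (k E : ℕ) (2≤k : 2 ≤ k) (1≤E : 1 ≤ E) where

    t : ℕ
    t = 1 + k * (2 * suc k)

    1≤k : 1 ≤ k
    1≤k = ≤-trans (s≤s z≤n) 2≤k

    private
      z : ℕ
      z = 8 * k
      1≤z : 1 ≤ z
      1≤z = *-mono-≤ (s≤s {n = 7} z≤n) 1≤k
      1≤P : 1 ≤ 32 * (k * k)
      1≤P = *-mono-≤ (s≤s {n = 31} z≤n) (*-mono-≤ 1≤k 1≤k)

    abstract
      a Q y S y′ H β threshold : ℕ
      a = 32 * (k * k) * (z * z)
      -- Two demands on the number of bad sets meet here: at most m / E for the conclusion, and at
      -- most m / 32k² for the size of the regular classes.
      Q = 32 * (k * k) * E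
      -- `y` and `y′` are the cofactors of 32k in S and H, the form in which `regular-large` reads
      -- off losses of at most 1/32k.
      y = 2 * (k * (z * z) * Q)
      S = 2 * (a * Q)
      y′ = 4 * y * (S * k)
      H = 4 * k * (S * S)
      -- The threshold b = 2^β is a power of two, so that 2^c = 2 · 2^e · b^t has a solution c;
      -- since β ≤ 2^β, it suffices to make β itself as large as b has to be.
      β = 32 * (k * k) * (S * S)
      threshold = suc (2 * suc k * (4 + 2 * (β * t)) + β)

      a≡ : a ≡ 32 * (k * k) * (z * z)
      a≡ = refl
      Q≡ : Q ≡ 32 * (k * k) * E
      Q≡ = refl
      S≡2aQ : S ≡ 2 * (a * Q)
      S≡2aQ = refl
      S≡ : S ≡ 32 * k * y
      S≡ = e1 k (z * z) Q
        where
        e1 : ∀ k M Q → 2 * (32 * (k * k) * M * Q) ≡ 32 * k * (2 * (k * M * Q))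
        e1 = solve-∀
      H≡4kSS : H ≡ 4 * k * (S * S)
      H≡4kSS = refl
      H≡ : H ≡ 32 * k * y′
      H≡ = trans (cong (λ x → 4 * k * (x * S)) S≡) (e1 k y S)
        where
        e1 : ∀ k y S → 4 * k * (32 * k * y * S) ≡ 32 * k * (4 * y * (S * k))
        e1 = solve-∀
      β≥ : 32 * (k * k) * (S * S) ≤ β
      β≥ = ≤-refl
      threshold≡ : threshold ≡ suc (2 * suc k * (4 + 2 * (β * t)) + β)
      threshold≡ = refl
      1≤a : 1 ≤ a
      1≤a = *-mono-≤ 1≤P (*-mono-≤ 1≤z 1≤z)
      1≤Q : 1 ≤ Q
      1≤Q = *-mono-≤ 1≤P 1≤E
      1≤y : 1 ≤ y
      1≤y = *-mono-≤ (s≤s {n = 1} z≤n) (*-mono-≤ (*-mono-≤ 1≤k (*-mono-≤ 1≤z 1≤z)) 1≤Q)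
      1≤S : 1 ≤ S
      1≤S = *-mono-≤ (s≤s {n = 1} z≤n) (*-mono-≤ 1≤a 1≤Q)
      1≤y′ : 1 ≤ y′
      1≤y′ = *-mono-≤ (*-mono-≤ (s≤s {n = 3} z≤n) 1≤y) (*-mono-≤ 1≤S 1≤k)
      1≤H : 1 ≤ H
      1≤H = *-mono-≤ (*-mono-≤ (s≤s {n = 3} z≤n) 1≤k) (*-mono-≤ 1≤S 1≤S)

    k≤H : k ≤ H
    k≤H = begin
      k                    ≡⟨ trans (*-identityʳ (1 * k)) (*-identityˡ k) ⟨
      1 * k * (1 * 1)      ≤⟨ *-mono-≤ (*-monoˡ-≤ k (s≤s {n = 3} z≤n)) (*-mono-≤ 1≤S 1≤S) ⟩
      4 * k * (S * S)      ≡⟨ H≡4kSS ⟨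
      H                    ∎
      where open ≤-Reasoning
    2Q≤β : 2 * Q ≤ β
    2Q≤β = begin
      2 * Q              ≡⟨ cong (2 *_) (sym (*-identityˡ Q)) ⟩
      2 * (1 * Q)        ≤⟨ *-monoʳ-≤ 2 (*-monoˡ-≤ Q 1≤a) ⟩
      2 * (a * Q)        ≡⟨ S≡2aQ ⟨
      S                  ≡⟨ trans (*-identityˡ (1 * S)) (*-identityˡ S) ⟨
      1 * (1 * S)        ≤⟨ *-mono-≤ 1≤P (*-monoˡ-≤ S 1≤S) ⟩
      32 * (k * k) * (S * S) ≤⟨ β≥ ⟩
      β                  ∎
      where open ≤-Reasoning

    module _ (d : ℕ) (threshold≤d : threshold ≤ d) where
      open ≤-Reasoning

      d≥ : suc (2 * suc k * (4 + 2 * (β * t)) + β) ≤ d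
      d≥ = ≤-trans (≤-reflexive (sym threshold≡)) threshold≤d

      -- e is about d / (2k + 2) plus a constant, so that e t exceeds n while (k + 1) c stays below d.
      w e c : ℕ
      w = 2 * suc k
      e = d / w + (3 + β * t)
      c = suc (e + β * t)

      β≤e : β ≤ e
      β≤e = begin
        β                      ≡⟨ *-identityʳ β ⟨
        β * 1                  ≤⟨ *-monoʳ-≤ β (s≤s (z≤n {k * (2 * suc k)})) ⟩
        β * t                  ≤⟨ m≤n+m (β * t) 3 ⟩
        3 + β * t              ≤⟨ m≤n+m (3 + β * t) (d / w) ⟩
        e                      ∎

      e≤c : e ≤ c
      e≤c = ≤-trans (m≤m+n e (β * t)) (n≤1+n (e + β * t))

      c≡ : 2 ^ c ≡ 2 * (2 ^ e * (2 ^ β) ^ t)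
      c≡ = cong (2 *_) (trans (^-distribˡ-+-* 2 e (β * t)) (cong (2 ^ e *_) (sym (^-*-assoc 2 β t))))

      -- Since t = 1 + k w, the product e t consists of one e, which pays for the e inside c, and k
      -- w copies of e, which pay for k d and for the constants.
      exponents : k * d + suc c ≤ e * t
      exponents = begin
        k * d + suc c                                ≤⟨ +-monoˡ-≤ (suc c) (*-monoʳ-≤ k d≤) ⟩
        k * (w + d / w * w) + suc c                  ≡⟨ e1 k w (d / w) e (β * t) ⟩
        k * w * (d / w + 1) + 1 * (2 + β * t) + e    ≤⟨ +-monoˡ-≤ e (+-monoʳ-≤ (k * w * (d / w + 1)) (*-monoˡ-≤ (2 + β * t) 1≤kw)) ⟩
        k * w * (d / w + 1) + k * w * (2 + β * t) + e ≡⟨ e2 (k * w) (d / w) (β * t) ⟩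
        e * t                                        ∎
        where
        1≤kw : 1 ≤ k * w
        1≤kw = *-mono-≤ 1≤k (s≤s z≤n)
        d≤ : d ≤ w + d / w * w
        d≤ = ≤-trans (≤-reflexive (m≡m%n+[m/n]*n d w)) (+-monoˡ-≤ (d / w * w) (<⇒≤ (m%n<n d w)))
        e1 : ∀ k w x e y → k * (w + x * w) + suc (suc (e + y)) ≡ k * w * (x + 1) + 1 * (2 + y) + e
        e1 = solve-∀
        e2 : ∀ v x y → v * (x + 1) + v * (2 + y) + (x + (3 + y)) ≡ (x + (3 + y)) * (1 + v)
        e2 = solve-∀

      -- Doubling turns k + 1 into w, so the main part d / w of c costs at most d; the choice of
      -- `threshold` makes the remaining constants less than the other d.
      c<d : suc k * c < d
      c<d = *-cancelˡ-< 2 (suc k * c) d (begin-strict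
        2 * (suc k * c)                             ≡⟨ e1 (suc k) (d / w) (β * t) ⟩
        d / w * w + w * (4 + 2 * (β * t))           <⟨ +-mono-≤-< (m/n*n≤m d w) (≤-trans (s≤s (m≤m+n _ β)) d≥) ⟩
        d + d                                       ≡⟨ cong (d +_) (+-identityʳ d) ⟨
        2 * d                                       ∎)
        where
        e1 : ∀ s x y → 2 * (s * suc (x + (3 + y) + y)) ≡ x * (2 * s) + 2 * s * (4 + 2 * y)
        e1 = solve-∀

      β≤d : β ≤ d
      β≤d = ≤-trans (m≤n+m β (2 * suc k * (4 + 2 * (β * t)))) (≤-trans (n≤1+n _) d≥)

      module _ {n : ℕ} (n≡ : n ≡ k * d) (F : List (Subset n)) (uniq : Unique F) (p : ℕ) (p+m≡ : p + length F ≡ length F * length F)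
        (size : H * (k * 2 ^ d) ≤ H * length F + k * 2 ^ d)
        (dense : k * H * p ≤ 2 * (k * H * comparablePairs F) + suc H * p) where

        private
          2^d≤m : 2 ^ d ≤ length F
          2^d≤m = 2^d≤size k H (2 ^ d) (length F) 2≤k 1≤H k≤H size

        stability : Σ (Tower n k d) λ T → Σ (List (Subset n)) λ Bad →
          (E * length Bad ≤ length F) × ((A : Subset n) → A ∈ F → A ∈ Bad ⊎ InTower T A)
        stability = Stability.tower-stability F uniq k d E a Q S H (2 ^ β) y y′ p
          n≡ 1≤k 1≤E 1≤a 1≤S 1≤y 1≤y′ (≤-trans (m^n>0 2 d) 2^d≤m)
          a≡ Q≡ S≡2aQ S≡ H≡4kSS H≡
          (≤-trans β≥ (n≤2^n β)) (≤-trans 2Q≤β (n≤2^n β))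
          -- The lower bound on m comes through 4k²S² ≤ β ≤ d ≤ 2^d ≤ m.
          (≤-trans (*-monoˡ-≤ (S * S) (*-monoˡ-≤ (k * k) (m≤m+n 4 28))) (≤-trans β≥ (≤-trans β≤d (≤-trans (n≤2^n d) 2^d≤m))))
          (few-at-level F (2 ^ β) uniq k d e t c n≡ 2^d≤m (^-monoʳ-≤ 2 β≤e) e≤c
            (subst (λ x → x + suc c ≤ e * t) (sym n≡) exponents) c≡ c<d)
          size p+m≡ dense

-- From rational hypotheses to natural numbers

open import Data.Nat using (ℕ; zero; suc; _^_; _∸_; _≤_; z≤n; s≤s) renaming (_+_ to _+ℕ_; _*_ to _*ℕ_)
open import Data.Nat.Combinatorics using (_C_; nC1≡n; nCk+nC[k+1]≡[n+1]C[k+1])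
import Data.Nat.Properties as ℕ
open import Data.Nat.Tactic.RingSolver using (solve-∀)
open import Data.Integer as ℤ using (+_; +[1+_])
import Data.Integer.Properties as ℤ
open import Data.Rational using (ℚ; 0ℚ; 1ℚ; mkℚ; _+_; _-_; _*_; _<_; _/_; toℚᵘ; nonNegative; positive; Positive; NonNegative) renaming (_≤_ to _≤ℚ_)
import Data.Rational.Properties as ℚ
open import Data.Rational.Solver using (module +-*-Solver)
open import Data.Rational.Unnormalised using (mkℚᵘ; *≡*; *≤*) renaming (_≃_ to _≃ᵘ_)
import Data.Rational.Unnormalised.Properties as ℚᵘ

toℚᵘ-ℕ→ℚ : ∀ x → toℚᵘ (ℕ→ℚ x) ≃ᵘ mkℚᵘ (+ x) 0
toℚᵘ-ℕ→ℚ x = ℚ.toℚᵘ-fromℚᵘ (mkℚᵘ (+ x) 0)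

ℕ→ℚ-+ : ∀ x y → ℕ→ℚ (x +ℕ y) ≡ ℕ→ℚ x + ℕ→ℚ y
ℕ→ℚ-+ x y = ℚ.toℚᵘ-injective (ℚᵘ.≃-trans (toℚᵘ-ℕ→ℚ (x +ℕ y)) (ℚᵘ.≃-sym (ℚᵘ.≃-trans (ℚ.toℚᵘ-homo-+ (ℕ→ℚ x) (ℕ→ℚ y))
  (ℚᵘ.≃-trans (ℚᵘ.+-cong (toℚᵘ-ℕ→ℚ x) (toℚᵘ-ℕ→ℚ y))
  (*≡* (cong (ℤ._* + 1) (cong₂ ℤ._+_ (ℤ.*-identityʳ (+ x)) (ℤ.*-identityʳ (+ y)))))))))

ℕ→ℚ-* : ∀ x y → ℕ→ℚ (x *ℕ y) ≡ ℕ→ℚ x * ℕ→ℚ y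
ℕ→ℚ-* x y = ℚ.toℚᵘ-injective (ℚᵘ.≃-trans (toℚᵘ-ℕ→ℚ (x *ℕ y)) (ℚᵘ.≃-sym (ℚᵘ.≃-trans (ℚ.toℚᵘ-homo-* (ℕ→ℚ x) (ℕ→ℚ y))
  (ℚᵘ.≃-trans (ℚᵘ.*-cong (toℚᵘ-ℕ→ℚ x) (toℚᵘ-ℕ→ℚ y)) (*≡* (cong (ℤ._* + 1) (sym (ℤ.pos-* x y))))))))

ℕ→ℚ-mono-≤ : ∀ {x y} → x ≤ y → ℕ→ℚ x ≤ℚ ℕ→ℚ y
ℕ→ℚ-mono-≤ {x} {y} x≤y = ℚ.toℚᵘ-cancel-≤ (ℚᵘ.≤-respˡ-≃ (ℚᵘ.≃-sym (toℚᵘ-ℕ→ℚ x)) (ℚᵘ.≤-respʳ-≃ (ℚᵘ.≃-sym (toℚᵘ-ℕ→ℚ y))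
  (*≤* (ℤ.*-monoʳ-≤-nonNeg (+ 1) (ℤ.+≤+ x≤y)))))

ℕ→ℚ-cancel-≤ : ∀ {x y} → ℕ→ℚ x ≤ℚ ℕ→ℚ y → x ≤ y
ℕ→ℚ-cancel-≤ {x} {y} le with ℚᵘ.≤-respˡ-≃ (toℚᵘ-ℕ→ℚ x) (ℚᵘ.≤-respʳ-≃ (toℚᵘ-ℕ→ℚ y) (ℚ.toℚᵘ-mono-≤ le))
... | *≤* le′ = ℤ.drop‿+≤+ (ℤ.*-cancelʳ-≤-pos (+ x) (+ y) (+ 1) le′)

recip : ℕ → ℚ
recip j = + 1 / suc j

toℚᵘ-recip : ∀ j → toℚᵘ (recip j) ≃ᵘ mkℚᵘ (+ 1) j
toℚᵘ-recip j = ℚ.toℚᵘ-fromℚᵘ (mkℚᵘ (+ 1) j)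

recip-inverse : ∀ j → ℕ→ℚ (suc j) * recip j ≡ 1ℚ
recip-inverse j = ℚ.toℚᵘ-injective (ℚᵘ.≃-trans (ℚ.toℚᵘ-homo-* (ℕ→ℚ (suc j)) (recip j))
  (ℚᵘ.≃-trans (ℚᵘ.*-cong (toℚᵘ-ℕ→ℚ (suc j)) (toℚᵘ-recip j))
  (*≡* (cong +_ (e1 j)))))
  where
  e1 : ∀ j → suc j *ℕ 1 *ℕ 1 ≡ 1 *ℕ (1 *ℕ suc j)
  e1 = solve-∀

recip-positive : ∀ j → 0ℚ < recip j
recip-positive j = ℚ.positive⁻¹ (recip j) {{ℚ.normalize-pos 1 (suc j)}}

-- The denominator of ε serves, as a positive numerator is at least 1.
archimedean : ∀ ε → 0ℚ < ε → ∃ λ j → recip j ≤ℚ ε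
archimedean ε 0<ε = bound ε {{positive 0<ε}}
  where
  bound : ∀ ε → .{{Positive ε}} → ∃ λ j → recip j ≤ℚ ε
  bound (mkℚ +[1+ p ] j c) = j , ℚ.toℚᵘ-cancel-≤ (ℚᵘ.≤-respˡ-≃ (ℚᵘ.≃-sym (toℚᵘ-recip j))
    (*≤* (ℤ.*-monoʳ-≤-nonNeg (+ suc j) (ℤ.+≤+ (s≤s (z≤n {p}))))))

ℕ→ℚ-nonNeg : ∀ x → NonNegative (ℕ→ℚ x)
ℕ→ℚ-nonNeg x = nonNegative (ℕ→ℚ-mono-≤ {0} {x} z≤n)

recip-scale : ∀ j x y ε → recip j ≤ℚ ε → suc j *ℕ x ≤ y → ℕ→ℚ x ≤ℚ ε * ℕ→ℚ y
recip-scale j x y ε r≤ε le = begin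
  ℕ→ℚ x                              ≡⟨ ℚ.*-identityˡ (ℕ→ℚ x) ⟨
  1ℚ * ℕ→ℚ x                         ≡⟨ cong (_* ℕ→ℚ x) (recip-inverse j) ⟨
  ℕ→ℚ (suc j) * recip j * ℕ→ℚ x      ≡⟨ cong (_* ℕ→ℚ x) (ℚ.*-comm (ℕ→ℚ (suc j)) (recip j)) ⟩
  recip j * ℕ→ℚ (suc j) * ℕ→ℚ x      ≡⟨ ℚ.*-assoc (recip j) (ℕ→ℚ (suc j)) (ℕ→ℚ x) ⟩
  recip j * (ℕ→ℚ (suc j) * ℕ→ℚ x)    ≡⟨ cong (recip j *_) (ℕ→ℚ-* (suc j) x) ⟨
  recip j * ℕ→ℚ (suc j *ℕ x)         ≤⟨ ℚ.*-monoˡ-≤-nonNeg (recip j) {{nonNegative (ℚ.<⇒≤ (recip-positive j))}} (ℕ→ℚ-mono-≤ le) ⟩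
  recip j * ℕ→ℚ y                    ≤⟨ ℚ.*-monoʳ-≤-nonNeg (ℕ→ℚ y) {{ℕ→ℚ-nonNeg y}} r≤ε ⟩
  ε * ℕ→ℚ y                          ∎
  where open ℚ.≤-Reasoning

-- Supplies p = m (m - 1) in the subtraction-free form p + m = m², which is how the density estimate
-- uses the number of pairs.
2*C2 : ∀ x → 2 *ℕ (x C 2) +ℕ x ≡ x *ℕ x
2*C2 zero    = refl
2*C2 (suc x) = begin
  2 *ℕ (suc x C 2) +ℕ suc x             ≡⟨ cong (λ c → 2 *ℕ c +ℕ suc x) (trans (sym (nCk+nC[k+1]≡[n+1]C[k+1] x 1)) (cong (_+ℕ x C 2) (nC1≡n x))) ⟩
  2 *ℕ (x +ℕ x C 2) +ℕ suc x            ≡⟨ e1 x (x C 2) ⟩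
  (2 *ℕ (x C 2) +ℕ x) +ℕ (2 *ℕ x +ℕ 1)  ≡⟨ cong (_+ℕ (2 *ℕ x +ℕ 1)) (2*C2 x) ⟩
  x *ℕ x +ℕ (2 *ℕ x +ℕ 1)               ≡⟨ e2 x ⟩
  suc x *ℕ suc x                        ∎
  where
  open ≡-Reasoning
  e1 : ∀ x c → 2 *ℕ (x +ℕ c) +ℕ suc x ≡ (2 *ℕ c +ℕ x) +ℕ (2 *ℕ x +ℕ 1)
  e1 = solve-∀
  e2 : ∀ x → x *ℕ x +ℕ (2 *ℕ x +ℕ 1) ≡ suc x *ℕ suc x
  e2 = solve-∀

-- Multiplication by 1/η, a natural number, turns the subtracted η term into a summand on the right.
clear-size : ∀ h k D m → (1ℚ - recip h) * ℕ→ℚ k * ℕ→ℚ D ≤ℚ ℕ→ℚ m → suc h *ℕ (k *ℕ D) ≤ suc h *ℕ m +ℕ k *ℕ D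
clear-size h k D m le = ℕ→ℚ-cancel-≤ (begin
  ℕ→ℚ (suc h *ℕ (k *ℕ D))
    ≡⟨ trans (ℕ→ℚ-* (suc h) (k *ℕ D)) (cong (η⁻¹ *_) (ℕ→ℚ-* k D)) ⟩
  η⁻¹ * (ℕ→ℚ k * ℕ→ℚ D)
    ≡⟨ expand η⁻¹ η (ℕ→ℚ k) (ℕ→ℚ D) ⟩
  η⁻¹ * ((1ℚ - η) * ℕ→ℚ k * ℕ→ℚ D) + η⁻¹ * η * (ℕ→ℚ k * ℕ→ℚ D)
    ≤⟨ ℚ.+-mono-≤ (ℚ.*-monoˡ-≤-nonNeg η⁻¹ {{ℕ→ℚ-nonNeg (suc h)}} le) (ℚ.≤-reflexive (trans (cong (_* (ℕ→ℚ k * ℕ→ℚ D)) (recip-inverse h)) (ℚ.*-identityˡ _))) ⟩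
  η⁻¹ * ℕ→ℚ m + ℕ→ℚ k * ℕ→ℚ D
    ≡⟨ trans (ℕ→ℚ-+ (suc h *ℕ m) (k *ℕ D)) (cong₂ _+_ (ℕ→ℚ-* (suc h) m) (ℕ→ℚ-* k D)) ⟨
  ℕ→ℚ (suc h *ℕ m +ℕ k *ℕ D) ∎)
  where
  open ℚ.≤-Reasoning
  η η⁻¹ : ℚ
  η   = recip h
  η⁻¹ = ℕ→ℚ (suc h)
  expand : ∀ u η K D → u * (K * D) ≡ u * ((1ℚ - η) * K * D) + u * η * (K * D)
  expand = +-*-Solver.solve 4 (λ u η K D → u :* (K :* D) := u :* ((con 1ℚ :- η) :* K :* D) :+ u :* η :* (K :* D)) refl
    where open +-*-Solver

-- Multiplication by k/η; the subtracted fraction becomes 1/η + 1, that is, `suc (suc h)`.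
clear-density : ∀ h j c x → (1ℚ - ((1ℚ + recip h) /ℕ suc j)) * ℕ→ℚ c ≤ℚ ℕ→ℚ x →
  suc h *ℕ suc j *ℕ c ≤ suc h *ℕ suc j *ℕ x +ℕ suc (suc h) *ℕ c
clear-density h j c x le = ℕ→ℚ-cancel-≤ (begin
  ℕ→ℚ (suc h *ℕ suc j *ℕ c)
    ≡⟨ trans (ℕ→ℚ-* (suc h *ℕ suc j) c) (cong (_* ℕ→ℚ c) (ℕ→ℚ-* (suc h) (suc j))) ⟩
  u * K * ℕ→ℚ c
    ≡⟨ expand u K η r (ℕ→ℚ c) ⟩
  u * K * ((1ℚ - ((1ℚ + η) * r)) * ℕ→ℚ c) + (u * η + u) * (K * r) * ℕ→ℚ c
    ≤⟨ ℚ.+-mono-≤ (ℚ.*-monoˡ-≤-nonNeg (u * K) {{subst NonNegative (ℕ→ℚ-* (suc h) (suc j)) (ℕ→ℚ-nonNeg (suc h *ℕ suc j))}} le)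
         (ℚ.≤-reflexive (cong (_* ℕ→ℚ c) inverses)) ⟩
  u * K * ℕ→ℚ x + ℕ→ℚ (suc (suc h)) * ℕ→ℚ c
    ≡⟨ trans (ℕ→ℚ-+ (suc h *ℕ suc j *ℕ x) (suc (suc h) *ℕ c))
         (cong₂ _+_ (trans (ℕ→ℚ-* (suc h *ℕ suc j) x) (cong (_* ℕ→ℚ x) (ℕ→ℚ-* (suc h) (suc j)))) (ℕ→ℚ-* (suc (suc h)) c)) ⟨
  ℕ→ℚ (suc h *ℕ suc j *ℕ x +ℕ suc (suc h) *ℕ c) ∎)
  where
  open ℚ.≤-Reasoning
  u K η r : ℚ
  u = ℕ→ℚ (suc h)
  K = ℕ→ℚ (suc j)
  η = recip h
  r = recip j
  inverses : (u * η + u) * (K * r) ≡ ℕ→ℚ (suc (suc h))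
  inverses = trans (cong₂ (λ v w → (v + u) * w) (recip-inverse h) (recip-inverse j))
    (trans (ℚ.*-identityʳ (1ℚ + u)) (sym (ℕ→ℚ-+ 1 (suc h))))
  expand : ∀ u K η r c → u * K * c ≡ u * K * ((1ℚ - ((1ℚ + η) * r)) * c) + (u * η + u) * (K * r) * c
  expand = +-*-Solver.solve 5 (λ u K η r c → u :* K :* c :=
    u :* K :* ((con 1ℚ :- ((con 1ℚ :+ η) :* r)) :* c) :+ (u :* η :+ u) :* (K :* r) :* c) refl
    where open +-*-Solver

theorem1p4 : (ε : ℚ) → 0ℚ < ε → (k : ℕ) → 2 ≤ k →
    Σ ℚ λ η → 0ℚ < η × Σ ℕ λ N →
    (n d : ℕ) → N ≤ n → n ≡ k *ℕ d →
    (F : List (Subset n)) → Unique F →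
    (1ℚ - η) * ℕ→ℚ k * ℕ→ℚ (2 ^ d) ≤ℚ ℕ→ℚ (length F) →
    (1ℚ - ((1ℚ + η) /ℕ k)) * ℕ→ℚ (length F C 2) ≤ℚ ℕ→ℚ (comparablePairs F) →
    Σ (Tower n k d) λ T → Σ (List (Subset n)) λ Bad →
    (ℕ→ℚ (length Bad) ≤ℚ ε * ℕ→ℚ (length F)) ×
    ((A : Subset n) → A ∈ F → A ∈ Bad ⊎ InTower T A)
theorem1p4 ε 0<ε k@(suc j) 2≤k with archimedean ε 0<ε
-- With E = i + 1 and h = H - 1, `recip h` is η = 1/H. Since n = k d, the bound n ≥ k · `threshold`
-- says d ≥ `threshold`.
... | i , 1/E≤ε = recip h , recip-positive h , k *ℕ threshold , λ n d N≤n n≡kd F uniq size dense →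
  let T , Bad , few , covers = stability d (ℕ.*-cancelˡ-≤ k (ℕ.≤-trans N≤n (ℕ.≤-reflexive n≡kd))) n≡kd F uniq
        (2 *ℕ (length F C 2)) (2*C2 (length F))
        (subst (λ u → u *ℕ (k *ℕ 2 ^ d) ≤ u *ℕ length F +ℕ k *ℕ 2 ^ d) suc-h (clear-size h k (2 ^ d) (length F) size))
        (subst (λ u → k *ℕ u *ℕ (2 *ℕ (length F C 2)) ≤ 2 *ℕ (k *ℕ u *ℕ comparablePairs F) +ℕ suc u *ℕ (2 *ℕ (length F C 2)))
          suc-h (double (suc h) k (length F C 2) (comparablePairs F) (clear-density h j (length F C 2) (comparablePairs F) dense)))
  in T , Bad , recip-scale i (length Bad) (length F) ε 1/E≤ε few , covers
  where
  open Families.Constants k (suc i) 2≤k (s≤s z≤n)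
  h : ℕ
  h = H ∸ 1
  suc-h : suc h ≡ H
  suc-h = ℕ.m+[n∸m]≡n 1≤H
  double : ∀ u k c x → u *ℕ k *ℕ c ≤ u *ℕ k *ℕ x +ℕ suc u *ℕ c → k *ℕ u *ℕ (2 *ℕ c) ≤ 2 *ℕ (k *ℕ u *ℕ x) +ℕ suc u *ℕ (2 *ℕ c)
  double u k c x le = begin
    k *ℕ u *ℕ (2 *ℕ c)                               ≡⟨ e1 u k c ⟩
    2 *ℕ (u *ℕ k *ℕ c)                               ≤⟨ ℕ.*-monoʳ-≤ 2 le ⟩
    2 *ℕ (u *ℕ k *ℕ x +ℕ suc u *ℕ c)                 ≡⟨ e2 u k c x ⟩
    2 *ℕ (k *ℕ u *ℕ x) +ℕ suc u *ℕ (2 *ℕ c)          ∎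
    where
    open ℕ.≤-Reasoning
    e1 : ∀ u k c → k *ℕ u *ℕ (2 *ℕ c) ≡ 2 *ℕ (u *ℕ k *ℕ c)
    e1 = solve-∀
    e2 : ∀ u k c x → 2 *ℕ (u *ℕ k *ℕ x +ℕ suc u *ℕ c) ≡ 2 *ℕ (k *ℕ u *ℕ x) +ℕ suc u *ℕ (2 *ℕ c)
    e2 = solve-∀
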